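{- Let $x_1,x_2,\ldots,y_1,y_2,\ldots$ be indeterminates. For every integer $n\ge 2$, the identity $$\sum_{k=1}^{n}(-1)^{k-1}\frac{y_k}{x_k}=\cfrac{a_1}{b_1+\cfrac{a_2}{b_2+\cdots+\cfrac{a_{3n-4}}{b_{3n-4}}}}$$ holds in the field of rational functions over $\mathbb{Q}$ in these indeterminates, where $$a_1=y_1^2,\quad a_2=x_1y_2,\quad a_3=\theta y_2,\quad a_4=x_1,$$ $$b_1=x_1y_1,\quad b_2=\theta x_1-\theta y_1,\quad b_3=\theta^2x_1-x_1,\quad b_4=1,$$ and for $k\ge 2$ $$a_{3k-1}=y_{k+1},\quad a_{3k}=y_k\,\theta^2y_k,\quad a_{3k+1}=1,$$ $$b_{3k-1}=x_ky_k-y_{k+1},\quad b_{3k}=\frac{\theta^2x_k-\theta^2y_k}{x_k}-1,\quad b_{3k+1}=1.$$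
   Context: For a sequence $(u_k)_{k\ge 1}$ of indeterminates, set $u_0=1$ and define, for $k\ge 0$, $\theta u_k=\dfrac{u_{k+1}}{u_k}$ and $\theta^2u_k=\theta(\theta u_k)=\dfrac{u_{k+2}u_k}{u_{k+1}^2}$. -}

module Defs where

open import Algebra.Apartness.Bundles using (HeytingCommutativeRing; HeytingField)
import Algebra.Apartness.Properties.HeytingCommutativeRing as HeytingProperties
open import Algebra.Bundles using (CommutativeRing)
import Algebra.Properties.Group as GroupProperties
import Algebra.Properties.Ring as RingProperties
import Algebra.Properties.Semiring.Exp as SemiringExp
import Algebra.Properties.Semiring.Sum as SemiringSum
import Algebra.Solver.Ring.NaturalCoefficients.Default as SemiringSolver
open import Data.Fin.Base using (toℕ)
open import Data.List.Base using (List; []; _∷_; _++_; deduplicate)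
open import Data.List.Membership.Propositional using (_∈_)
open import Data.List.Membership.Propositional.Properties
  using (∈-++⁺ˡ; ∈-++⁺ʳ; ∈-deduplicate⁺)
open import Data.List.Relation.Binary.Subset.Propositional using (_⊆_)
open import Data.List.Relation.Unary.All as All using (All; []; _∷_)
open import Data.List.Relation.Unary.AllPairs using ([]; _∷_)
open import Data.List.Relation.Unary.Any using (here; there)
open import Data.List.Relation.Unary.Unique.Propositional using (Unique)
open import Data.List.Relation.Unary.Unique.DecPropositional.Properties
  using (deduplicate-!)
open import Data.Nat.Base as ℕ using (ℕ; zero; suc)
import Data.Nat.Properties as ℕₚ
open import Data.Product.Base using (Σ; Σ-syntax; _×_; _,_; proj₁; proj₂)
open import Data.Rational.Base as ℚ using (ℚ; 0ℚ; 1ℚ)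
import Data.Rational.Properties as ℚₚ
open import Data.Sum.Base using (_⊎_; inj₁; inj₂)
open import Data.Unit.Base using (⊤; tt)
open import Function.Base using (_∘_)
open import Level using (Level; 0ℓ; Lift)
open import Relation.Binary.Definitions using (Decidable; DecidableEquality)
open import Relation.Binary.PropositionalEquality as ≡ using (_≡_; _≢_)
import Relation.Binary.Reasoning.Setoid as SetoidReasoning
open import Relation.Nullary.Decidable using (Dec; yes; no; map′; _×-dec_; decidable-stable)
open import Relation.Nullary.Negation using (¬_; contradiction)

-- The polynomial ring ℚ[V], as the free commutative ℚ-algebra on V:
-- `_≈ᴾ_` is the congruence generated by the commutative ring laws and by
-- the requirement that `con` be a ring homomorphism (`con 1ℚ` is the unit
-- and `con 0ℚ` the zero of the ring laws).

module Polynomial where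

  infix  8 -ᴾ_
  infixl 7 _*ᴾ_
  infixl 6 _+ᴾ_
  infix  4 _≈ᴾ_

  data Poly (V : Set) : Set where
    con  : ℚ → Poly V
    var  : V → Poly V
    _+ᴾ_ : Poly V → Poly V → Poly V
    _*ᴾ_ : Poly V → Poly V → Poly V
    -ᴾ_  : Poly V → Poly V

  data _≈ᴾ_ {V : Set} : Poly V → Poly V → Set where
    refl       : ∀ {p} → p ≈ᴾ p
    sym        : ∀ {p q} → p ≈ᴾ q → q ≈ᴾ p
    trans      : ∀ {p q r} → p ≈ᴾ q → q ≈ᴾ r → p ≈ᴾ r
    +-cong     : ∀ {p p′ q q′} → p ≈ᴾ p′ → q ≈ᴾ q′ → p +ᴾ q ≈ᴾ p′ +ᴾ q′
    *-cong     : ∀ {p p′ q q′} → p ≈ᴾ p′ → q ≈ᴾ q′ → p *ᴾ q ≈ᴾ p′ *ᴾ q′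
    neg-cong   : ∀ {p p′} → p ≈ᴾ p′ → -ᴾ p ≈ᴾ -ᴾ p′
    +-assoc    : ∀ p q r → (p +ᴾ q) +ᴾ r ≈ᴾ p +ᴾ (q +ᴾ r)
    +-comm     : ∀ p q → p +ᴾ q ≈ᴾ q +ᴾ p
    +-identity : ∀ p → con 0ℚ +ᴾ p ≈ᴾ p
    +-inverse  : ∀ p → -ᴾ p +ᴾ p ≈ᴾ con 0ℚ
    *-assoc    : ∀ p q r → (p *ᴾ q) *ᴾ r ≈ᴾ p *ᴾ (q *ᴾ r)
    *-comm     : ∀ p q → p *ᴾ q ≈ᴾ q *ᴾ p
    *-identity : ∀ p → con 1ℚ *ᴾ p ≈ᴾ p
    distrib    : ∀ p q r → p *ᴾ (q +ᴾ r) ≈ᴾ p *ᴾ q +ᴾ p *ᴾ r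
    con-+      : ∀ a b → con (a ℚ.+ b) ≈ᴾ con a +ᴾ con b
    con-*      : ∀ a b → con (a ℚ.* b) ≈ᴾ con a *ᴾ con b

  polyRing : Set → CommutativeRing 0ℓ 0ℓ
  polyRing V = record
    { Carrier = Poly V
    ; _≈_ = _≈ᴾ_
    ; _+_ = _+ᴾ_
    ; _*_ = _*ᴾ_
    ; -_ = -ᴾ_
    ; 0# = con 0ℚ
    ; 1# = con 1ℚ
    ; isCommutativeRing = record
      { isRing = record
        { +-isAbelianGroup = record
          { isGroup = record
            { isMonoid = record
              { isSemigroup = record
                { isMagma = record
                  { isEquivalence = record { refl = refl ; sym = sym ; trans = trans }
                  ; ∙-cong = +-cong
                  }
                ; assoc = +-assoc
                }
              ; identity = +-identity , λ p → trans (+-comm p _) (+-identity p)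
              }
            ; inverse = +-inverse , λ p → trans (+-comm p _) (+-inverse p)
            ; ⁻¹-cong = neg-cong
            }
          ; comm = +-comm
          }
        ; *-cong = *-cong
        ; *-assoc = *-assoc
        ; *-identity = *-identity , λ p → trans (*-comm p _) (*-identity p)
        ; distrib = distrib , λ p q r →
            trans (*-comm _ p) (trans (distrib p q r) (+-cong (*-comm p q) (*-comm p r)))
        }
      ; *-comm = *-comm
      }
    }

open Polynomial using
  (Poly; con; var; _+ᴾ_; _*ᴾ_; -ᴾ_; _≈ᴾ_; polyRing)

-- Formal power series.  They only serve as a model in which polynomials
-- can be separated, to show that ℚ[V] is a discrete integral domain.

module PowerSeries {c ℓ : Level} (R : CommutativeRing c ℓ) where
  open CommutativeRing R hiding (zero)
  open SetoidReasoning setoid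
  open SemiringSolver commutativeSemiring using (solve; _:+_; _:*_; _:=_)

  Series : Set c
  Series = ℕ → Carrier

  tail : Series → Series
  tail f n = f (suc n)

  const : Carrier → Series
  const r zero    = r
  const r (suc n) = 0#

  X : Series
  X zero    = 0#
  X (suc n) = const 1# n

  infixl 7 _⊛_
  _⊛_ : Series → Series → Series
  (f ⊛ g) zero    = f zero * g zero
  (f ⊛ g) (suc n) = f zero * g (suc n) + (tail f ⊛ g) n

  ⊛-cong : ∀ {f f′ g g′} → (∀ n → f n ≈ f′ n) → (∀ n → g n ≈ g′ n) →
           ∀ n → (f ⊛ g) n ≈ (f′ ⊛ g′) n
  ⊛-cong p q zero    = *-cong (p 0) (q 0)
  ⊛-cong p q (suc n) = +-cong (*-cong (p 0) (q (suc n))) (⊛-cong (p ∘ suc) q n)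

  ⊛-zeroˡ : ∀ f g → (∀ n → f n ≈ 0#) → ∀ n → (f ⊛ g) n ≈ 0#
  ⊛-zeroˡ f g p zero    = trans (*-congʳ (p 0)) (zeroˡ _)
  ⊛-zeroˡ f g p (suc n) = begin
    f 0 * g (suc n) + (tail f ⊛ g) n  ≈⟨ +-cong (*-congʳ (p 0)) (⊛-zeroˡ (tail f) g (p ∘ suc) n) ⟩
    0# * g (suc n) + 0#               ≈⟨ +-identityʳ _ ⟩
    0# * g (suc n)                    ≈⟨ zeroˡ _ ⟩
    0#                                ∎

  const-⊛ : ∀ r g n → (const r ⊛ g) n ≈ r * g n
  const-⊛ r g zero    = refl
  const-⊛ r g (suc n) =
    trans (+-congˡ (⊛-zeroˡ _ g (λ _ → refl) n)) (+-identityʳ _)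

  ⊛-sucʳ : ∀ f g n → (f ⊛ g) (suc n) ≈ f (suc n) * g 0 + (f ⊛ tail g) n
  ⊛-sucʳ f g zero    = +-comm _ _
  ⊛-sucʳ f g (suc n) = begin
    f 0 * g (2 ℕ.+ n) + (tail f ⊛ g) (suc n)
      ≈⟨ +-congˡ (⊛-sucʳ (tail f) g n) ⟩
    f 0 * g (2 ℕ.+ n) + (f (2 ℕ.+ n) * g 0 + (tail f ⊛ tail g) n)
      ≈⟨ solve 3 (λ a b c → a :+ (b :+ c) := b :+ (a :+ c)) refl _ _ _ ⟩
    f (2 ℕ.+ n) * g 0 + (f 0 * g (2 ℕ.+ n) + (tail f ⊛ tail g) n) ∎

  ⊛-comm : ∀ f g n → (f ⊛ g) n ≈ (g ⊛ f) n
  ⊛-comm f g zero    = *-comm _ _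
  ⊛-comm f g (suc n) = begin
    f 0 * g (suc n) + (tail f ⊛ g) n  ≈⟨ +-cong (*-comm _ _) (⊛-comm (tail f) g n) ⟩
    g (suc n) * f 0 + (g ⊛ tail f) n  ≈⟨ ⊛-sucʳ g f n ⟨
    (g ⊛ f) (suc n)                   ∎

  ⊛-distribʳ : ∀ h f g n → ((λ m → f m + g m) ⊛ h) n ≈ (f ⊛ h) n + (g ⊛ h) n
  ⊛-distribʳ h f g zero    = distribʳ _ _ _
  ⊛-distribʳ h f g (suc n) = begin
    (f 0 + g 0) * h (suc n) + ((λ m → tail f m + tail g m) ⊛ h) n
      ≈⟨ +-congˡ (⊛-distribʳ h (tail f) (tail g) n) ⟩
    (f 0 + g 0) * h (suc n) + ((tail f ⊛ h) n + (tail g ⊛ h) n)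
      ≈⟨ solve 5 (λ a b c d e → (a :+ b) :* c :+ (d :+ e) := a :* c :+ d :+ (b :* c :+ e))
           refl _ _ _ _ _ ⟩
    f 0 * h (suc n) + (tail f ⊛ h) n + (g 0 * h (suc n) + (tail g ⊛ h) n) ∎

  ⊛-scale : ∀ r f g n → ((λ m → r * f m) ⊛ g) n ≈ r * (f ⊛ g) n
  ⊛-scale r f g zero    = *-assoc _ _ _
  ⊛-scale r f g (suc n) = begin
    r * f 0 * g (suc n) + ((λ m → r * tail f m) ⊛ g) n
      ≈⟨ +-congˡ (⊛-scale r (tail f) g n) ⟩
    r * f 0 * g (suc n) + r * (tail f ⊛ g) n
      ≈⟨ solve 4 (λ a b c d → a :* b :* c :+ a :* d := a :* (b :* c :+ d)) refl _ _ _ _ ⟩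
    r * (f 0 * g (suc n) + (tail f ⊛ g) n) ∎

  ⊛-assoc : ∀ f g h n → ((f ⊛ g) ⊛ h) n ≈ (f ⊛ (g ⊛ h)) n
  ⊛-assoc f g h zero    = *-assoc _ _ _
  ⊛-assoc f g h (suc n) = begin
    f 0 * g 0 * h (suc n) + ((λ m → f 0 * tail g m + (tail f ⊛ g) m) ⊛ h) n
      ≈⟨ +-congˡ (⊛-distribʳ h (λ m → f 0 * tail g m) (tail f ⊛ g) n) ⟩
    f 0 * g 0 * h (suc n) + (((λ m → f 0 * tail g m) ⊛ h) n + ((tail f ⊛ g) ⊛ h) n)
      ≈⟨ +-congˡ (+-cong (⊛-scale (f 0) (tail g) h n) (⊛-assoc (tail f) g h n)) ⟩
    f 0 * g 0 * h (suc n) + (f 0 * (tail g ⊛ h) n + (tail f ⊛ (g ⊛ h)) n)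
      ≈⟨ solve 5 (λ a b c d e → a :* b :* c :+ (a :* d :+ e) := a :* (b :* c :+ d) :+ e)
           refl _ _ _ _ _ ⟩
    f 0 * (g 0 * h (suc n) + (tail g ⊛ h) n) + (tail f ⊛ (g ⊛ h)) n ∎

  const-1-⊛ : ∀ f n → (const 1# ⊛ f) n ≈ f n
  const-1-⊛ f n = trans (const-⊛ 1# f n) (*-identityˡ _)

  seriesRing : CommutativeRing c ℓ
  seriesRing = record
    { Carrier = Series
    ; _≈_ = λ f g → ∀ n → f n ≈ g n
    ; _+_ = λ f g n → f n + g n
    ; _*_ = _⊛_
    ; -_ = λ f n → - f n
    ; 0# = λ _ → 0#
    ; 1# = const 1#
    ; isCommutativeRing = record
      { isRing = record
        { +-isAbelianGroup = record
          { isGroup = record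
            { isMonoid = record
              { isSemigroup = record
                { isMagma = record
                  { isEquivalence = record
                    { refl = λ _ → refl
                    ; sym = λ p n → sym (p n)
                    ; trans = λ p q n → trans (p n) (q n)
                    }
                  ; ∙-cong = λ p q n → +-cong (p n) (q n)
                  }
                ; assoc = λ _ _ _ _ → +-assoc _ _ _
                }
              ; identity = (λ _ _ → +-identityˡ _) , (λ _ _ → +-identityʳ _)
              }
            ; inverse = (λ _ _ → -‿inverseˡ _) , (λ _ _ → -‿inverseʳ _)
            ; ⁻¹-cong = λ p n → -‿cong (p n)
            }
          ; comm = λ _ _ _ → +-comm _ _
          }
        ; *-cong = ⊛-cong
        ; *-assoc = ⊛-assoc
        ; *-identity = const-1-⊛ , (λ f n → trans (⊛-comm f _ n) (const-1-⊛ f n))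
        ; distrib =
            (λ f g h n → trans (⊛-comm f _ n) (trans (⊛-distribʳ f g h n)
                           (+-cong (⊛-comm g f n) (⊛-comm h f n))))
          , ⊛-distribʳ
        }
      ; *-comm = ⊛-comm
      }
    }

  module _
    (stable : ∀ x → ¬ ¬ (x ≈ 0#) → x ≈ 0#)
    (noZeroDivisors : ∀ x y → ¬ x ≈ 0# → ¬ y ≈ 0# → ¬ x * y ≈ 0#)
    where

    ⊛-cancel₀ : ∀ f g → ¬ f 0 ≈ 0# → (∀ n → (f ⊛ g) n ≈ 0#) → ∀ n → g n ≈ 0#
    ⊛-cancel₀ f g f₀≉0 fg≈0 zero    =
      stable _ λ g₀≉0 → noZeroDivisors _ _ f₀≉0 g₀≉0 (fg≈0 0)
    ⊛-cancel₀ f g f₀≉0 fg≈0 (suc n) = ⊛-cancel₀ f (tail g) f₀≉0 (λ m → begin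
      (f ⊛ tail g) m                      ≈⟨ +-identityˡ _ ⟨
      0# + (f ⊛ tail g) m                 ≈⟨ +-congʳ (trans (*-congˡ (⊛-cancel₀ f g f₀≉0 fg≈0 0)) (zeroʳ _)) ⟨
      f (suc m) * g 0 + (f ⊛ tail g) m    ≈⟨ ⊛-sucʳ f g m ⟨
      (f ⊛ g) (suc m)                     ≈⟨ fg≈0 (suc m) ⟩
      0#                                  ∎) n

    ⊛-cancel : ∀ k f g → ¬ f k ≈ 0# → (∀ n → (f ⊛ g) n ≈ 0#) → ∀ n → g n ≈ 0#
    ⊛-cancel zero    f g fₖ≉0 fg≈0 n = ⊛-cancel₀ f g fₖ≉0 fg≈0 n
    ⊛-cancel (suc k) f g fₖ≉0 fg≈0 n = stable _ λ gₙ≉0 →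
      gₙ≉0 (⊛-cancel₀ f g (λ f₀≈0 →
        gₙ≉0 (⊛-cancel k (tail f) g fₖ≉0 (λ m → begin
          (tail f ⊛ g) m                    ≈⟨ +-identityˡ _ ⟨
          0# + (tail f ⊛ g) m               ≈⟨ +-congʳ (trans (*-congʳ f₀≈0) (zeroˡ _)) ⟨
          f 0 * g (suc m) + (tail f ⊛ g) m  ≈⟨ fg≈0 (suc m) ⟩
          0#                                ∎) n)) fg≈0 n)

    series-noZeroDivisors : ∀ f g → ¬ (∀ n → f n ≈ 0#) → ¬ (∀ n → g n ≈ 0#) →
                            ¬ (∀ n → (f ⊛ g) n ≈ 0#)
    series-noZeroDivisors f g f≉0 g≉0 fg≈0 =
      f≉0 λ k → stable _ λ fₖ≉0 → g≉0 (⊛-cancel k f g fₖ≉0 fg≈0)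

record ℚ-Domain : Set₁ where
  field
    commutativeRing : CommutativeRing 0ℓ 0ℓ
  open CommutativeRing commutativeRing public
  field
    ι      : ℚ → Carrier
    ι-+    : ∀ a b → ι (a ℚ.+ b) ≈ ι a + ι b
    ι-*    : ∀ a b → ι (a ℚ.* b) ≈ ι a * ι b
    ι-0    : ι 0ℚ ≈ 0#
    ι-1    : ι 1ℚ ≈ 1#
    stable : ∀ x → ¬ ¬ (x ≈ 0#) → x ≈ 0#
    noZeroDivisors : ∀ x y → ¬ x ≈ 0# → ¬ y ≈ 0# → ¬ x * y ≈ 0#

ℚ-domain : ℚ-Domain
ℚ-domain = record
  { commutativeRing = ℚₚ.+-*-commutativeRing
  ; ι = λ a → a
  ; ι-+ = λ _ _ → ≡.refl
  ; ι-* = λ _ _ → ≡.refl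
  ; ι-0 = ≡.refl
  ; ι-1 = ≡.refl
  ; stable = λ a → decidable-stable (a ℚₚ.≟ 0ℚ)
  ; noZeroDivisors = λ _ _ →
      HeytingProperties.x#0y#0→xy#0 ℚₚ.heytingCommutativeRing
  }

series-domain : ℚ-Domain → ℚ-Domain
series-domain D = record
  { commutativeRing = seriesRing
  ; ι = const ∘ ι
  ; ι-+ = λ { a b zero → ι-+ a b ; a b (suc n) → sym (+-identityˡ _) }
  ; ι-* = λ { a b n → trans (const-* a b n) (sym (const-⊛ (ι a) (const (ι b)) n)) }
  ; ι-0 = λ { zero → ι-0 ; (suc n) → refl }
  ; ι-1 = λ { zero → ι-1 ; (suc n) → refl }
  ; stable = λ f f≈0 n → stable (f n) λ fₙ≉0 → f≈0 λ f≈0 → fₙ≉0 (f≈0 n)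
  ; noZeroDivisors = series-noZeroDivisors stable noZeroDivisors
  }
  where
  open ℚ-Domain D hiding (zero)
  open PowerSeries commutativeRing

  const-* : ∀ a b n → const (ι (a ℚ.* b)) n ≈ ι a * const (ι b) n
  const-* a b zero    = ι-* a b
  const-* a b (suc n) = sym (zeroʳ _)

module Evaluation {V : Set} (D : ℚ-Domain)
                  (ρ : V → CommutativeRing.Carrier (ℚ-Domain.commutativeRing D)) where
  open Polynomial
  private module D = ℚ-Domain D
  open D using (_≈_)

  eval : Poly V → D.Carrier
  eval (con a)  = D.ι a
  eval (var v)  = ρ v
  eval (p +ᴾ q) = eval p D.+ eval q
  eval (p *ᴾ q) = eval p D.* eval q
  eval (-ᴾ p)   = D.- eval p

  eval-cong : ∀ {p q} → p ≈ᴾ q → eval p ≈ eval q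
  eval-cong refl             = D.refl
  eval-cong (sym e)          = D.sym (eval-cong e)
  eval-cong (trans e e′)     = D.trans (eval-cong e) (eval-cong e′)
  eval-cong (+-cong e e′)    = D.+-cong (eval-cong e) (eval-cong e′)
  eval-cong (*-cong e e′)    = D.*-cong (eval-cong e) (eval-cong e′)
  eval-cong (neg-cong e)     = D.-‿cong (eval-cong e)
  eval-cong (+-assoc p q r)  = D.+-assoc _ _ _
  eval-cong (+-comm p q)     = D.+-comm _ _
  eval-cong (+-identity p)   = D.trans (D.+-congʳ D.ι-0) (D.+-identityˡ _)
  eval-cong (+-inverse p)    = D.trans (D.-‿inverseˡ _) (D.sym D.ι-0)
  eval-cong (*-assoc p q r)  = D.*-assoc _ _ _
  eval-cong (*-comm p q)     = D.*-comm _ _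
  eval-cong (*-identity p)   = D.trans (D.*-congʳ D.ι-1) (D.*-identityˡ _)
  eval-cong (distrib p q r)  = D.distribˡ _ _ _
  eval-cong (con-+ a b)      = D.ι-+ a b
  eval-cong (con-* a b)      = D.ι-* a b

1≉0 : ∀ {V} → ¬ con {V} 1ℚ ≈ᴾ con 0ℚ
1≉0 e = ℚₚ.1≢0 (Evaluation.eval-cong ℚ-domain (λ _ → 0ℚ) e)

var≉0 : ∀ {V} (v : V) → ¬ var v ≈ᴾ con 0ℚ
var≉0 v e = ℚₚ.1≢0 (Evaluation.eval-cong ℚ-domain (λ _ → 1ℚ) e)

module PolyDomain {V : Set} (_≟ⱽ_ : DecidableEquality V) where
  open Polynomial
  open CommutativeRing (polyRing V)
    using (ring; +-group; setoid; commutativeSemiring; zeroˡ; zeroʳ; +-identityʳ; +-congˡ; +-congʳ; *-congˡ; *-congʳ)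
  open SetoidReasoning setoid
  open SemiringSolver commutativeSemiring using (solve; _:+_; _:*_; _:=_)
  open RingProperties ring using (-0#≈0#; -‿distribʳ-*; -‿+-comm)
  open GroupProperties +-group using ()
    renaming (x∙y⁻¹≈ε⇒x≈y to x-y≈0⇒x≈y; x≈y⇒x∙y⁻¹≈ε to x≈y⇒x-y≈0)

  domain : List V → ℚ-Domain
  domain []       = ℚ-domain
  domain (w ∷ vs) = series-domain (domain vs)

  ρ : ∀ vs → V → ℚ-Domain.Carrier (domain vs)
  ρ []       u = 0ℚ
  ρ (w ∷ vs) u with w ≟ⱽ u
  ... | yes _ = PowerSeries.X (ℚ-Domain.commutativeRing (domain vs))
  ... | no  _ = PowerSeries.const (ℚ-Domain.commutativeRing (domain vs)) (ρ vs u)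

  private module E (vs : List V) = Evaluation (domain vs) (ρ vs)
  open E using (eval; eval-cong)

  Over : List V → Poly V → Set
  Over vs (con a)  = ⊤
  Over vs (var v)  = v ∈ vs
  Over vs (p +ᴾ q) = Over vs p × Over vs q
  Over vs (p *ᴾ q) = Over vs p × Over vs q
  Over vs (-ᴾ p)   = Over vs p

  vars : Poly V → List V
  vars (con a)  = []
  vars (var v)  = v ∷ []
  vars (p +ᴾ q) = vars p ++ vars q
  vars (p *ᴾ q) = vars p ++ vars q
  vars (-ᴾ p)   = vars p

  over-⊆ : ∀ p {vs} → vars p ⊆ vs → Over vs p
  over-⊆ (con a)  s = tt
  over-⊆ (var v)  s = s (here ≡.refl)
  over-⊆ (p +ᴾ q) s = over-⊆ p (s ∘ ∈-++⁺ˡ) , over-⊆ q (s ∘ ∈-++⁺ʳ (vars p))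
  over-⊆ (p *ᴾ q) s = over-⊆ p (s ∘ ∈-++⁺ˡ) , over-⊆ q (s ∘ ∈-++⁺ʳ (vars p))
  over-⊆ (-ᴾ p)   s = over-⊆ p s

  horner : V → List (Poly V) → Poly V
  horner w []       = con 0ℚ
  horner w (c ∷ cs) = c +ᴾ var w *ᴾ horner w cs

  module _ (w : V) (vs : List V) where

    Horner : Poly V → Set
    Horner p = Σ[ cs ∈ List (Poly V) ] All (Over vs) cs × p ≈ᴾ horner w cs

    horner-+ : ∀ {cs ds} → All (Over vs) cs → All (Over vs) ds →
               Horner (horner w cs +ᴾ horner w ds)
    horner-+ {ds = ds} [] od = ds , od , +-identity _
    horner-+ {cs} (c ∷ oc) [] = cs , c ∷ oc , +-identityʳ _
    horner-+ {p ∷ cs} {q ∷ ds} (c ∷ oc) (d ∷ od) with horner-+ oc od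
    ... | es , oe , eq = (p +ᴾ q) ∷ es , (c , d) ∷ oe , (begin
      p +ᴾ var w *ᴾ horner w cs +ᴾ (q +ᴾ var w *ᴾ horner w ds)
        ≈⟨ solve 5 (λ p q x c d → p :+ x :* c :+ (q :+ x :* d) := p :+ q :+ x :* (c :+ d))
             refl p q (var w) (horner w cs) (horner w ds) ⟩
      p +ᴾ q +ᴾ var w *ᴾ (horner w cs +ᴾ horner w ds)
        ≈⟨ +-congˡ (*-congˡ eq) ⟩
      p +ᴾ q +ᴾ var w *ᴾ horner w es ∎)

    horner-scale : ∀ p {cs} → Over vs p → All (Over vs) cs → Horner (p *ᴾ horner w cs)
    horner-scale p o [] = [] , [] , zeroʳ p
    horner-scale p {q ∷ cs} o (c ∷ oc) with horner-scale p o oc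
    ... | es , oe , eq = (p *ᴾ q) ∷ es , (o , c) ∷ oe , (begin
      p *ᴾ (q +ᴾ var w *ᴾ horner w cs)
        ≈⟨ solve 4 (λ p q x c → p :* (q :+ x :* c) := p :* q :+ x :* (p :* c))
             refl p q (var w) (horner w cs) ⟩
      p *ᴾ q +ᴾ var w *ᴾ (p *ᴾ horner w cs)
        ≈⟨ +-congˡ (*-congˡ eq) ⟩
      p *ᴾ q +ᴾ var w *ᴾ horner w es ∎)

    horner-* : ∀ {cs ds} → All (Over vs) cs → All (Over vs) ds →
               Horner (horner w cs *ᴾ horner w ds)
    horner-* [] od = [] , [] , zeroˡ _
    horner-* {p ∷ cs} {ds} (c ∷ oc) od with horner-* oc od | horner-scale p c od
    ... | es , oe , eq | fs , of , eq′ with horner-+ of (_∷_ {x = con 0ℚ} tt oe)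
    ... | gs , og , eq″ = gs , og , (begin
      (p +ᴾ var w *ᴾ horner w cs) *ᴾ horner w ds
        ≈⟨ solve 4 (λ p x c d → (p :+ x :* c) :* d := p :* d :+ x :* (c :* d))
             refl p (var w) (horner w cs) (horner w ds) ⟩
      p *ᴾ horner w ds +ᴾ var w *ᴾ (horner w cs *ᴾ horner w ds)
        ≈⟨ +-cong eq′ (trans (*-congˡ eq) (sym (+-identity _))) ⟩
      horner w fs +ᴾ (con 0ℚ +ᴾ var w *ᴾ horner w es)
        ≈⟨ eq″ ⟩
      horner w gs ∎)

    horner-neg : ∀ {cs} → All (Over vs) cs → Horner (-ᴾ horner w cs)
    horner-neg [] = [] , [] , -0#≈0#
    horner-neg {p ∷ cs} (c ∷ oc) with horner-neg oc
    ... | es , oe , eq = (-ᴾ p) ∷ es , c ∷ oe , (begin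
      -ᴾ (p +ᴾ var w *ᴾ horner w cs)          ≈⟨ -‿+-comm _ _ ⟨
      -ᴾ p +ᴾ -ᴾ (var w *ᴾ horner w cs)       ≈⟨ +-congˡ (-‿distribʳ-* _ _) ⟩
      -ᴾ p +ᴾ var w *ᴾ -ᴾ horner w cs         ≈⟨ +-congˡ (*-congˡ eq) ⟩
      -ᴾ p +ᴾ var w *ᴾ horner w es            ∎)

    horner-const : ∀ p → Over vs p → Horner p
    horner-const p o = p ∷ [] , o ∷ [] , sym (trans (+-congˡ (zeroʳ _)) (+-identityʳ _))

    toHorner : ∀ p → Over (w ∷ vs) p → Horner p
    toHorner (con a) o = horner-const (con a) tt
    toHorner (var .w) (here ≡.refl) = con 0ℚ ∷ con 1ℚ ∷ [] , tt ∷ tt ∷ [] , sym (begin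
      con 0ℚ +ᴾ var w *ᴾ (con 1ℚ +ᴾ var w *ᴾ con 0ℚ)  ≈⟨ +-identity _ ⟩
      var w *ᴾ (con 1ℚ +ᴾ var w *ᴾ con 0ℚ)            ≈⟨ *-congˡ (+-congˡ (zeroʳ _)) ⟩
      var w *ᴾ (con 1ℚ +ᴾ con 0ℚ)                     ≈⟨ *-congˡ (+-identityʳ _) ⟩
      var w *ᴾ con 1ℚ                                 ≈⟨ *-comm _ _ ⟩
      con 1ℚ *ᴾ var w                                 ≈⟨ *-identity _ ⟩
      var w                                           ∎)
    toHorner (var v) (there v∈vs) = horner-const (var v) v∈vs
    toHorner (p +ᴾ q) (o , o′) with toHorner p o | toHorner q o′
    ... | cs , oc , eq | ds , od , eq′ with horner-+ oc od
    ... | es , oe , eq″ = es , oe , trans (+-cong eq eq′) eq″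
    toHorner (p *ᴾ q) (o , o′) with toHorner p o | toHorner q o′
    ... | cs , oc , eq | ds , od , eq′ with horner-* oc od
    ... | es , oe , eq″ = es , oe , trans (*-cong eq eq′) eq″
    toHorner (-ᴾ p) o with toHorner p o
    ... | cs , oc , eq with horner-neg oc
    ... | es , oe , eq″ = es , oe , trans (neg-cong eq) eq″

    private
      module D = ℚ-Domain (domain vs)
      module S = ℚ-Domain (domain (w ∷ vs))
    open PowerSeries D.commutativeRing using (const; X; const-⊛; const-1-⊛)

    eval-const : All (w ≢_) vs → ∀ p → Over vs p →
                 S._≈_ (eval (w ∷ vs) p) (const (eval vs p))
    eval-const w∉ (con a) o n = D.refl
    eval-const w∉ (var v) o n with w ≟ⱽ v
    ... | yes w≡v = contradiction w≡v (All.lookup w∉ o)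
    ... | no  _   = D.refl
    eval-const w∉ (p +ᴾ q) (o , o′) n =
      D.trans (D.+-cong (eval-const w∉ p o n) (eval-const w∉ q o′ n)) (lemma n)
      where
      lemma : ∀ n → const (eval vs p) n D.+ const (eval vs q) n D.≈ const (eval vs p D.+ eval vs q) n
      lemma zero    = D.refl
      lemma (suc n) = D.+-identityˡ _
    eval-const w∉ (p *ᴾ q) (o , o′) n =
      D.trans (S.*-cong (eval-const w∉ p o) (eval-const w∉ q o′) n)
        (D.trans (const-⊛ _ _ n) (lemma n))
      where
      lemma : ∀ n → eval vs p D.* const (eval vs q) n D.≈ const (eval vs p D.* eval vs q) n
      lemma zero    = D.refl
      lemma (suc n) = D.zeroʳ _
    eval-const w∉ (-ᴾ p) o n =
      D.trans (D.-‿cong (eval-const w∉ p o n)) (lemma n)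
      where
      lemma : ∀ n → D.- const (eval vs p) n D.≈ const (D.- eval vs p) n
      lemma zero    = D.refl
      lemma (suc n) = RingProperties.-0#≈0# D.ring

    eval-var : ∀ n → eval (w ∷ vs) (var w) n D.≈ X n
    eval-var n with w ≟ⱽ w
    ... | yes _  = D.refl
    ... | no w≢w = contradiction ≡.refl w≢w

    eval-horner : All (w ≢_) vs → ∀ {cs} → All (Over vs) cs →
                  S._≈_ (eval (w ∷ vs) (horner w cs)) S.0# →
                  All (λ c → eval vs c D.≈ D.0#) cs
    eval-horner w∉ [] e = []
    eval-horner w∉ {c ∷ cs} (o ∷ oc) e = head≈0 ∷ eval-horner w∉ oc rest≈0
      where
      h = eval (w ∷ vs) (horner w cs)

      expand : ∀ n → const (eval vs c) n D.+ S._*_ X h n D.≈ D.0#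
      expand n = D.trans (D.sym (D.+-cong (eval-const w∉ c o n)
                   (S.*-cong {y = X} {u = h} {v = h} eval-var (λ _ → D.refl) n))) (e n)

      head≈0 : eval vs c D.≈ D.0#
      head≈0 = D.trans (D.sym (D.trans (D.+-congˡ (D.zeroˡ _)) (D.+-identityʳ _))) (expand 0)

      rest≈0 : ∀ n → h n D.≈ D.0#
      rest≈0 n = D.trans
        (D.sym (D.trans (D.+-identityˡ _)
          (D.trans (D.+-congʳ (D.zeroˡ _)) (D.trans (D.+-identityˡ _) (const-1-⊛ h n)))))
        (expand (suc n))

    horner-0 : ∀ {cs} → All (_≈ᴾ con 0ℚ) cs → horner w cs ≈ᴾ con 0ℚ
    horner-0 []       = refl
    horner-0 (e ∷ es) = trans (+-cong e (trans (*-congˡ (horner-0 es)) (zeroʳ _))) (+-identity _)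

  constant : ∀ p → Over [] p → p ≈ᴾ con (eval [] p)
  constant (con a)  o        = refl
  constant (p +ᴾ q) (o , o′) = trans (+-cong (constant p o) (constant q o′)) (sym (con-+ _ _))
  constant (p *ᴾ q) (o , o′) = trans (*-cong (constant p o) (constant q o′)) (sym (con-* _ _))
  constant (-ᴾ p)   o        = begin
    -ᴾ p                                    ≈⟨ neg-cong (constant p o) ⟩
    -ᴾ con a                                ≈⟨ +-identityʳ _ ⟨
    -ᴾ con a +ᴾ con 0ℚ                      ≡⟨ ≡.cong (λ b → -ᴾ con a +ᴾ con b) (ℚₚ.+-inverseʳ a) ⟨
    -ᴾ con a +ᴾ con (a ℚ.+ ℚ.- a)           ≈⟨ +-congˡ (con-+ _ _) ⟩
    -ᴾ con a +ᴾ (con a +ᴾ con (ℚ.- a))      ≈⟨ +-assoc _ _ _ ⟨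
    -ᴾ con a +ᴾ con a +ᴾ con (ℚ.- a)        ≈⟨ +-congʳ (+-inverse _) ⟩
    con 0ℚ +ᴾ con (ℚ.- a)                   ≈⟨ +-identity _ ⟩
    con (ℚ.- a)                             ∎
    where a = eval [] p

  eval≈0⇒≈0 : ∀ vs → Unique vs → ∀ p → Over vs p →
              ℚ-Domain._≈_ (domain vs) (eval vs p) (ℚ-Domain.0# (domain vs)) → p ≈ᴾ con 0ℚ
  eval≈0⇒≈0 [] _ p o e = trans (constant p o) (≡.subst (λ a → con {V} (eval [] p) ≈ᴾ con a) e refl)
  eval≈0⇒≈0 (w ∷ vs) (w∉ ∷ u) p o e with toHorner w vs p o
  ... | cs , oc , eq = trans eq (horner-0 w vs (coefficients≈0 oc
          (eval-horner w vs w∉ oc (λ n → D.trans (D.sym (eval-cong (w ∷ vs) eq n)) (e n)))))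
    where
    module D = ℚ-Domain (domain vs)
    coefficients≈0 : ∀ {cs} → All (Over vs) cs → All (λ c → eval vs c D.≈ D.0#) cs →
                     All (_≈ᴾ con 0ℚ) cs
    coefficients≈0 []       []       = []
    coefficients≈0 (o ∷ oc) (e ∷ es) = eval≈0⇒≈0 vs u _ o e ∷ coefficients≈0 oc es

  ≈0⇒eval≈0 : ∀ vs {p} → p ≈ᴾ con 0ℚ →
              ℚ-Domain._≈_ (domain vs) (eval vs p) (ℚ-Domain.0# (domain vs))
  ≈0⇒eval≈0 vs e = ℚ-Domain.trans (domain vs) (eval-cong vs e) (ℚ-Domain.ι-0 (domain vs))

  zero? : ∀ vs → Unique vs → ∀ p → Over vs p → Dec (p ≈ᴾ con 0ℚ)
  zero? [] u p o = map′ (eval≈0⇒≈0 [] u p o) (≈0⇒eval≈0 []) (eval [] p ℚₚ.≟ 0ℚ)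
  zero? (w ∷ vs) (w∉ ∷ u) p o with toHorner w vs p o
  ... | cs , oc , eq = map′ (λ z → trans eq (horner-0 w vs z)) coefficients≈0 (all-zero? oc)
    where
    coefficients≈0 : p ≈ᴾ con 0ℚ → All (_≈ᴾ con 0ℚ) cs
    coefficients≈0 e = All.zipWith (λ (o , e) → eval≈0⇒≈0 vs u _ o e)
      (oc , eval-horner w vs w∉ oc (≈0⇒eval≈0 (w ∷ vs) (trans (sym eq) e)))

    all-zero? : ∀ {cs} → All (Over vs) cs → Dec (All (_≈ᴾ con 0ℚ) cs)
    all-zero? []       = yes []
    all-zero? (o ∷ oc) = map′ (λ (z , zs) → z ∷ zs) (λ { (z ∷ zs) → z , zs })
                           (zero? vs u _ o ×-dec all-zero? oc)

  support : Poly V → List V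
  support p = deduplicate _≟ⱽ_ (vars p)

  support-! : ∀ p → Unique (support p)
  support-! p = deduplicate-! _≟ⱽ_ (vars p)

  over-support : ∀ p → Over (support p) p
  over-support p = over-⊆ p (∈-deduplicate⁺ _≟ⱽ_)

  _≟ᴾ_ : Decidable (_≈ᴾ_ {V})
  p ≟ᴾ q = map′ (x-y≈0⇒x≈y p q) x≈y⇒x-y≈0
             (zero? _ (support-! d) d (over-support d))
    where d = p +ᴾ -ᴾ q

  poly-noZeroDivisors : ∀ p q → ¬ p ≈ᴾ con 0ℚ → ¬ q ≈ᴾ con 0ℚ → ¬ p *ᴾ q ≈ᴾ con 0ℚ
  poly-noZeroDivisors p q p≉0 q≉0 pq≈0 =
    ℚ-Domain.noZeroDivisors (domain vs) (eval vs p) (eval vs q)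
      (p≉0 ∘ eval≈0⇒≈0 vs u p (proj₁ o)) (q≉0 ∘ eval≈0⇒≈0 vs u q (proj₂ o))
      (≈0⇒eval≈0 vs {p *ᴾ q} pq≈0)
    where
    vs = support (p *ᴾ q)
    u  = support-! (p *ᴾ q)
    o  = over-support (p *ᴾ q)

record DiscreteIntegralDomain (c ℓ : Level) : Set (Level.suc (c Level.⊔ ℓ)) where
  field
    commutativeRing : CommutativeRing c ℓ
  open CommutativeRing commutativeRing public
  field
    _≟_            : Decidable _≈_
    1#≉0#          : ¬ 1# ≈ 0#
    noZeroDivisors : ∀ x y → ¬ x ≈ 0# → ¬ y ≈ 0# → ¬ x * y ≈ 0#

module FieldOfFractions {c ℓ : Level} (D : DiscreteIntegralDomain c ℓ) where
  open DiscreteIntegralDomain D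
    renaming (refl to ≈-refl; sym to ≈-sym; trans to ≈-trans)
    hiding (_-_; zero)
  open SetoidReasoning setoid
  open SemiringSolver commutativeSemiring using (solve; _:+_; _:*_; _:=_)
  open RingProperties ring using (-‿distribˡ-*; -‿distribʳ-*)
  open GroupProperties +-group using ()
    renaming (x∙y⁻¹≈ε⇒x≈y to x-y≈0⇒x≈y; x≈y⇒x∙y⁻¹≈ε to x≈y⇒x-y≈0)

  infix 4 _≃_
  infix 5 _÷_∣_

  record Fraction : Set (c Level.⊔ ℓ) where
    constructor _÷_∣_
    field
      num   : Carrier
      den   : Carrier
      den≉0 : ¬ den ≈ 0#
  open Fraction public

  record _≃_ (p q : Fraction) : Set ℓ where
    constructor cross
    field
      uncross : num p * den q ≈ num q * den p
  open _≃_ public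

  infix  8 -ᶠ_
  infixl 7 _*ᶠ_
  infixl 6 _+ᶠ_

  _+ᶠ_ : Fraction → Fraction → Fraction
  (a ÷ b ∣ b≉0) +ᶠ (c ÷ d ∣ d≉0) = a * d + c * b ÷ b * d ∣ noZeroDivisors b d b≉0 d≉0

  _*ᶠ_ : Fraction → Fraction → Fraction
  (a ÷ b ∣ b≉0) *ᶠ (c ÷ d ∣ d≉0) = a * c ÷ b * d ∣ noZeroDivisors b d b≉0 d≉0

  -ᶠ_ : Fraction → Fraction
  -ᶠ (a ÷ b ∣ b≉0) = - a ÷ b ∣ b≉0

  fromBase : Carrier → Fraction
  fromBase a = a ÷ 1# ∣ 1#≉0#

  cancel : ∀ {d x y} → ¬ d ≈ 0# → d * x ≈ d * y → x ≈ y
  cancel {d} {x} {y} d≉0 e = decidable-stable (x ≟ y) λ x≉y →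
    noZeroDivisors d (x + - y) d≉0 (x≉y ∘ x-y≈0⇒x≈y x y) (begin
      d * (x + - y)      ≈⟨ distribˡ _ _ _ ⟩
      d * x + d * - y    ≈⟨ +-congˡ (-‿distribʳ-* d y) ⟨
      d * x + - (d * y)  ≈⟨ x≈y⇒x-y≈0 e ⟩
      0#                 ∎)

  ≃-trans : ∀ {p q r} → p ≃ q → q ≃ r → p ≃ r
  ≃-trans {a ÷ b ∣ _} {c ÷ d ∣ d≉0} {e ÷ f ∣ _} (cross ad≈cb) (cross cf≈ed) =
    cross (cancel d≉0 (begin
      d * (a * f)  ≈⟨ solve 3 (λ d a f → d :* (a :* f) := a :* d :* f) ≈-refl d a f ⟩
      a * d * f    ≈⟨ *-congʳ ad≈cb ⟩
      c * b * f    ≈⟨ solve 3 (λ c b f → c :* b :* f := c :* f :* b) ≈-refl c b f ⟩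
      c * f * b    ≈⟨ *-congʳ cf≈ed ⟩
      e * d * b    ≈⟨ solve 3 (λ d e b → e :* d :* b := d :* (e :* b)) ≈-refl d e b ⟩
      d * (e * b)  ∎))

  +ᶠ-cong : ∀ {p p′ q q′} → p ≃ p′ → q ≃ q′ → p +ᶠ q ≃ p′ +ᶠ q′
  +ᶠ-cong {a ÷ b ∣ _} {a′ ÷ b′ ∣ _} {c ÷ d ∣ _} {c′ ÷ d′ ∣ _} (cross e) (cross e′) =
    cross (begin
      (a * d + c * b) * (b′ * d′)
        ≈⟨ solve 6 (λ a b c d b′ d′ → (a :* d :+ c :* b) :* (b′ :* d′)
                      := a :* b′ :* (d :* d′) :+ c :* d′ :* (b :* b′)) ≈-refl a b c d b′ d′ ⟩
      a * b′ * (d * d′) + c * d′ * (b * b′)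
        ≈⟨ +-cong (*-congʳ e) (*-congʳ e′) ⟩
      a′ * b * (d * d′) + c′ * d * (b * b′)
        ≈⟨ solve 6 (λ a′ b c′ d b′ d′ → a′ :* b :* (d :* d′) :+ c′ :* d :* (b :* b′)
                      := (a′ :* d′ :+ c′ :* b′) :* (b :* d)) ≈-refl a′ b c′ d b′ d′ ⟩
      (a′ * d′ + c′ * b′) * (b * d) ∎)

  *ᶠ-cong : ∀ {p p′ q q′} → p ≃ p′ → q ≃ q′ → p *ᶠ q ≃ p′ *ᶠ q′
  *ᶠ-cong {a ÷ b ∣ _} {a′ ÷ b′ ∣ _} {c ÷ d ∣ _} {c′ ÷ d′ ∣ _} (cross e) (cross e′) =
    cross (begin
      a * c * (b′ * d′)
        ≈⟨ solve 4 (λ a c b′ d′ → a :* c :* (b′ :* d′) := a :* b′ :* (c :* d′)) ≈-refl a c b′ d′ ⟩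
      a * b′ * (c * d′)
        ≈⟨ *-cong e e′ ⟩
      a′ * b * (c′ * d)
        ≈⟨ solve 4 (λ a′ b c′ d → a′ :* b :* (c′ :* d) := a′ :* c′ :* (b :* d)) ≈-refl a′ b c′ d ⟩
      a′ * c′ * (b * d) ∎)

  -ᶠ-cong : ∀ {p q} → p ≃ q → -ᶠ p ≃ -ᶠ q
  -ᶠ-cong {a ÷ b ∣ _} {c ÷ d ∣ _} (cross e) =
    cross (≈-trans (≈-sym (-‿distribˡ-* a d)) (≈-trans (-‿cong e) (-‿distribˡ-* c b)))

  +ᶠ-comm : ∀ p q → p +ᶠ q ≃ q +ᶠ p
  +ᶠ-comm (a ÷ b ∣ _) (c ÷ d ∣ _) =
    cross (*-cong (+-comm _ _) (*-comm _ _))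

  +ᶠ-assoc : ∀ p q r → (p +ᶠ q) +ᶠ r ≃ p +ᶠ (q +ᶠ r)
  +ᶠ-assoc (a ÷ b ∣ _) (c ÷ d ∣ _) (e ÷ f ∣ _) = cross
    (solve 6 (λ a b c d e f →
      ((a :* d :+ c :* b) :* f :+ e :* (b :* d)) :* (b :* (d :* f))
        := (a :* (d :* f) :+ (c :* f :+ e :* d) :* b) :* (b :* d :* f))
      ≈-refl a b c d e f)

  *ᶠ-comm : ∀ p q → p *ᶠ q ≃ q *ᶠ p
  *ᶠ-comm (a ÷ b ∣ _) (c ÷ d ∣ _) =
    cross (*-cong (*-comm _ _) (*-comm _ _))

  *ᶠ-assoc : ∀ p q r → (p *ᶠ q) *ᶠ r ≃ p *ᶠ (q *ᶠ r)
  *ᶠ-assoc (a ÷ b ∣ _) (c ÷ d ∣ _) (e ÷ f ∣ _) =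
    cross (*-cong (*-assoc _ _ _) (≈-sym (*-assoc _ _ _)))

  distribᶠ : ∀ p q r → p *ᶠ (q +ᶠ r) ≃ p *ᶠ q +ᶠ p *ᶠ r
  distribᶠ (a ÷ b ∣ _) (c ÷ d ∣ _) (e ÷ f ∣ _) = cross
    (solve 6 (λ a b c d e f →
      a :* (c :* f :+ e :* d) :* (b :* d :* (b :* f))
        := (a :* c :* (b :* f) :+ a :* e :* (b :* d)) :* (b :* (d :* f)))
      ≈-refl a b c d e f)

  +ᶠ-identityˡ : ∀ p → fromBase 0# +ᶠ p ≃ p
  +ᶠ-identityˡ (a ÷ b ∣ _) = cross (begin
    (0# * b + a * 1#) * b  ≈⟨ *-congʳ (+-cong (zeroˡ b) (*-identityʳ a)) ⟩
    (0# + a) * b           ≈⟨ *-cong (+-identityˡ a) (≈-sym (*-identityˡ b)) ⟩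
    a * (1# * b)           ∎)

  *ᶠ-identityˡ : ∀ p → fromBase 1# *ᶠ p ≃ p
  *ᶠ-identityˡ (a ÷ b ∣ _) =
    cross (*-cong (*-identityˡ a) (≈-sym (*-identityˡ b)))

  +ᶠ-inverseˡ : ∀ p → -ᶠ p +ᶠ p ≃ fromBase 0#
  +ᶠ-inverseˡ (a ÷ b ∣ _) = cross (begin
    (- a * b + a * b) * 1#  ≈⟨ *-identityʳ _ ⟩
    - a * b + a * b         ≈⟨ distribʳ b (- a) a ⟨
    (- a + a) * b           ≈⟨ *-congʳ (-‿inverseˡ a) ⟩
    0# * b                  ≈⟨ zeroˡ b ⟩
    0#                      ≈⟨ zeroˡ (b * b) ⟨
    0# * (b * b)            ∎)

  fractionRing : CommutativeRing (c Level.⊔ ℓ) ℓ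
  fractionRing = record
    { Carrier = Fraction
    ; _≈_ = _≃_
    ; _+_ = _+ᶠ_
    ; _*_ = _*ᶠ_
    ; -_ = -ᶠ_
    ; 0# = fromBase 0#
    ; 1# = fromBase 1#
    ; isCommutativeRing = record
      { isRing = record
        { +-isAbelianGroup = record
          { isGroup = record
            { isMonoid = record
              { isSemigroup = record
                { isMagma = record
                  { isEquivalence = record
                    { refl = cross ≈-refl
                    ; sym = λ e → cross (≈-sym (uncross e))
                    ; trans = ≃-trans
                    }
                  ; ∙-cong = +ᶠ-cong
                  }
                ; assoc = +ᶠ-assoc
                }
              ; identity = +ᶠ-identityˡ , λ p → ≃-trans (+ᶠ-comm p (fromBase 0#)) (+ᶠ-identityˡ p)
              }
            ; inverse = +ᶠ-inverseˡ , λ p → ≃-trans (+ᶠ-comm p (-ᶠ p)) (+ᶠ-inverseˡ p)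
            ; ⁻¹-cong = -ᶠ-cong
            }
          ; comm = +ᶠ-comm
          }
        ; *-cong = *ᶠ-cong
        ; *-assoc = *ᶠ-assoc
        ; *-identity = *ᶠ-identityˡ , λ p → ≃-trans (*ᶠ-comm p (fromBase 1#)) (*ᶠ-identityˡ p)
        ; distrib = distribᶠ , λ p q r →
            ≃-trans (*ᶠ-comm (q +ᶠ r) p) (≃-trans (distribᶠ p q r) (+ᶠ-cong (*ᶠ-comm p q) (*ᶠ-comm p r)))
        }
      ; *-comm = *ᶠ-comm
      }
    }

  private module F = CommutativeRing fractionRing

  fromBase≄0 : ∀ {a} → ¬ a ≈ 0# → ¬ fromBase a ≃ fromBase 0#
  fromBase≄0 a≉0 (cross e) =
    a≉0 (≈-trans (≈-sym (*-identityʳ _)) (≈-trans e (*-identityʳ _)))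

  _≟ᶠ_ : Decidable _≃_
  p ≟ᶠ q = map′ cross uncross ((num p * den q) ≟ (num q * den p))

  num≉0 : ∀ {p} → ¬ p ≃ fromBase 0# → ¬ num p ≈ 0#
  num≉0 {a ÷ b ∣ _} p≄0 a≈0 = p≄0 (cross (begin
    a * 1#  ≈⟨ *-congʳ a≈0 ⟩
    0# * 1# ≈⟨ zeroˡ 1# ⟩
    0#      ≈⟨ zeroˡ b ⟨
    0# * b  ∎))

  invert : ∀ p → ¬ p ≃ fromBase 0# → Fraction
  invert p p≄0 = den p ÷ num p ∣ num≉0 p≄0

  invert-inverseˡ : ∀ p p≄0 → invert p p≄0 *ᶠ p ≃ fromBase 1#
  invert-inverseˡ (a ÷ b ∣ _) p≄0 = cross (begin
    b * a * 1#    ≈⟨ *-identityʳ _ ⟩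
    b * a         ≈⟨ *-comm b a ⟩
    a * b         ≈⟨ *-identityˡ _ ⟨
    1# * (a * b)  ∎)

  x-y≄0 : ∀ {x y} → ¬ x ≃ y → ¬ x F.- y ≃ fromBase 0#
  x-y≄0 {x} {y} x≄y = x≄y ∘ GroupProperties.x∙y⁻¹≈ε⇒x≈y F.+-group x y

  field-of-fractions : HeytingField (c Level.⊔ ℓ) ℓ ℓ
  field-of-fractions = record
    { Carrier = Fraction
    ; _≈_ = _≃_
    ; _#_ = λ p q → ¬ p ≃ q
    ; _+_ = _+ᶠ_
    ; _*_ = _*ᶠ_
    ; -_ = -ᶠ_
    ; 0# = fromBase 0#
    ; 1# = fromBase 1#
    ; isHeytingField = record
      { isHeytingCommutativeRing = record
        { isCommutativeRing = F.isCommutativeRing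
        ; isApartnessRelation = record
          { irrefl = λ e x≄y → x≄y e
          ; sym = λ x≄y → x≄y ∘ F.sym
          ; cotrans = cotransitive
          }
        ; #⇒invertible = λ {x} {y} x≄y →
            let z = x F.- y ; z≄0 = x-y≄0 x≄y in
            invert z z≄0 , invert-inverseˡ z z≄0 ,
            F.trans (F.*-comm z (invert z z≄0)) (invert-inverseˡ z z≄0)
        ; invertible⇒# = λ {x} {y} (z , z[x-y]≈1 , _) x≃y → fromBase≄0 1#≉0#
            (F.trans (F.sym z[x-y]≈1)
              (F.trans (F.*-congˡ {z} (GroupProperties.x≈y⇒x∙y⁻¹≈ε F.+-group x≃y)) (F.zeroʳ z)))
        }
      ; tight = λ x y → decidable-stable (x ≟ᶠ y) , λ e x≄y → x≄y e
      }
    }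
    where
    cotransitive : ∀ {x y} → ¬ x ≃ y → ∀ z → ¬ x ≃ z ⊎ ¬ z ≃ y
    cotransitive {x} x≄y z with x ≟ᶠ z
    ... | no  x≄z = inj₁ x≄z
    ... | yes x≃z = inj₂ (x≄y ∘ F.trans x≃z)

module InField {c ℓ₁ ℓ₂ : Level} (F : HeytingField c ℓ₁ ℓ₂) where
  open HeytingField F hiding (zero)
  open HeytingCommutativeRing heytingCommutativeRing using (commutativeRing)
  open CommutativeRing commutativeRing using (semiring)
  open HeytingProperties heytingCommutativeRing
  open SemiringSum semiring using (sum)
  open SemiringExp semiring using (_^_)

  infix  9 _⁻¹
  infixl 7 _/_ _⊘_

  record Nonzero : Set (c Level.⊔ ℓ₂) where
    constructor ⟪_,_⟫
    field
      ⟦_⟧     : Carrier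
      nonzero : ⟦_⟧ # 0#
  open Nonzero public

  -- `#⇒invertible` inverts the difference z - 0#.
  _⁻¹ : Nonzero → Nonzero
  z ⁻¹ = ⟪ w , invertibleʳ⇒# (⟦ z ⟧ , (begin
    (w - 0#) * ⟦ z ⟧  ≈⟨ *-cong (x-0≈x w) (sym (x-0≈x ⟦ z ⟧)) ⟩
    w * (⟦ z ⟧ - 0#)  ≈⟨ w[z-0]≈1 ⟩
    1#                ∎)) ⟫
    where
    open SetoidReasoning setoid
    w         = proj₁ (#⇒invertible (nonzero z))
    w[z-0]≈1  = proj₁ (proj₂ (#⇒invertible (nonzero z)))

  _/_ : Carrier → Nonzero → Carrier
  w / z = w * ⟦ z ⁻¹ ⟧

  _⊘_ : Nonzero → Nonzero → Nonzero
  w ⊘ z = ⟪ ⟦ w ⟧ / z , x#0y#0→xy#0 (nonzero w) (nonzero (z ⁻¹)) ⟫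

  θ : (ℕ → Nonzero) → (ℕ → Nonzero)
  θ u k = u (suc k) ⊘ u k

  θ² : (ℕ → Nonzero) → (ℕ → Nonzero)
  θ² u = θ (θ u)

  -- `Defined a b i m` says that no denominator vanishes in
  --   a i / (b i + a (i + 1) / (b (i + 1) + ⋯ / b (i + m - 1))),
  -- the continued fraction with m partial quotients starting at index i;
  -- `value` is the element it denotes (0 when m is 0).
  Defined : (a b : ℕ → Carrier) (i m : ℕ) → Set ℓ₂
  value   : ∀ a b i m → Defined a b i m → Carrier

  Defined a b i zero    = Lift ℓ₂ ⊤
  Defined a b i (suc m) =
    Σ[ d ∈ Defined a b (suc i) m ] b i + value a b (suc i) m d # 0#

  value a b i zero    _         = 0#
  value a b i (suc m) (d , d#0) = a i / ⟪ b i + value a b (suc i) m d , d#0 ⟫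

  -- The index i : Fin n stands for k = i + 1.
  alternatingSum : (x y : ℕ → Nonzero) → ℕ → Carrier
  alternatingSum x y n =
    sum {n} (λ i → (- 1#) ^ toℕ i * (⟦ y (suc (toℕ i)) ⟧ / x (suc (toℕ i))))

  module Coefficients (x y : ℕ → Nonzero) where

    -- aFrom j k and bFrom j k are the coefficients of index 3k - 1 + j.
    aFrom bFrom : ℕ → ℕ → Carrier

    aFrom 0 k = ⟦ y (suc k) ⟧
    aFrom 1 k = ⟦ y k ⟧ * ⟦ θ² y k ⟧
    aFrom 2 k = 1#
    aFrom (suc (suc (suc j))) k = aFrom j (suc k)

    bFrom 0 k = ⟦ x k ⟧ * ⟦ y k ⟧ - ⟦ y (suc k) ⟧
    bFrom 1 k = (⟦ θ² x k ⟧ - ⟦ θ² y k ⟧) / x k - 1#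
    bFrom 2 k = 1#
    bFrom (suc (suc (suc j))) k = bFrom j (suc k)

    -- Coefficients are indexed from 1; the value at 0 is irrelevant.
    a b : ℕ → Carrier

    a 0 = 0#
    a 1 = ⟦ y 1 ⟧ ^ 2
    a 2 = ⟦ x 1 ⟧ * ⟦ y 2 ⟧
    a 3 = ⟦ θ y 2 ⟧
    a 4 = ⟦ x 1 ⟧
    a (suc (suc (suc (suc (suc j))))) = aFrom j 2

    b 0 = 0#
    b 1 = ⟦ x 1 ⟧ * ⟦ y 1 ⟧
    b 2 = ⟦ θ x 1 ⟧ - ⟦ θ y 1 ⟧
    b 3 = ⟦ θ² x 1 ⟧ - ⟦ x 1 ⟧
    b 4 = 1#
    b (suc (suc (suc (suc (suc j))))) = bFrom j 2

-- `X k` and `Y k` are the indeterminates x_{k+1} and y_{k+1}.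
data Indeterminate : Set where
  X Y : ℕ → Indeterminate

_≟ⁱ_ : DecidableEquality Indeterminate
X i ≟ⁱ X j = map′ (≡.cong X) (λ { ≡.refl → ≡.refl }) (i ℕₚ.≟ j)
X i ≟ⁱ Y j = no λ ()
Y i ≟ⁱ X j = no λ ()
Y i ≟ⁱ Y j = map′ (≡.cong Y) (λ { ≡.refl → ≡.refl }) (i ℕₚ.≟ j)

ℚ[x,y] : DiscreteIntegralDomain 0ℓ 0ℓ
ℚ[x,y] = record
  { commutativeRing = polyRing Indeterminate
  ; _≟_ = _≟ᴾ_
  ; 1#≉0# = 1≉0
  ; noZeroDivisors = poly-noZeroDivisors
  }
  where open PolyDomain _≟ⁱ_

open FieldOfFractions ℚ[x,y] using (fromBase; fromBase≄0; field-of-fractions)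

ℚ⟮x,y⟯ : HeytingField 0ℓ 0ℓ 0ℓ
ℚ⟮x,y⟯ = field-of-fractions

open HeytingField ℚ⟮x,y⟯ public using (_≈_)
open InField ℚ⟮x,y⟯ public

indeterminates : (ℕ → Indeterminate) → ℕ → Nonzero
indeterminates u zero    = ⟪ fromBase (con 1ℚ) , fromBase≄0 1≉0 ⟫
indeterminates u (suc k) = ⟪ fromBase (var (u k)) , fromBase≄0 (var≉0 (u k)) ⟫

x y : ℕ → Nonzero
x = indeterminates X
y = indeterminates Y

open Coefficients x y public using (a; b)

{-# OPTIONS --safe #-}

-- Put r k = y_k / x_k and, for a fixed n, let S_k = r k − r (k+1) + ⋯ ± r n.
-- With G_k = S_{k+1}² − S_k S_{k+2}, the part R_k of the continued fraction that
-- starts at a_{3k} satisfies R_k G_k = y_k² S_{k+2} for 2 ≤ k < n, by downward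
-- induction on k; the quotients with index at most 4 then collapse to S_1.  Each
-- denominator is a product of terms x_k, y_k, S_k, G_k and
-- H_k = (x_k y_k − y_{k+1}) G_k + y_k² S_{k+2} and their inverses.  These do not
-- vanish: S_k takes the value 1 at the point where all x are 1 and y is the basis
-- vector e_k, and G_k, H_k take the values 1, −1 where y is e_{k+1}.

module Submission where

open import Algebra.Apartness.Bundles using (HeytingCommutativeRing; HeytingField)
import Algebra.Apartness.Properties.HeytingCommutativeRing as HeytingProperties
open import Algebra.Bundles using (CommutativeRing)
import Algebra.Properties.Group as GroupProperties
import Algebra.Properties.Ring as RingProperties
import Algebra.Properties.Semiring.Exp as SemiringExp
import Algebra.Properties.Semiring.Sum as SemiringSum
import Algebra.Solver.Ring.NaturalCoefficients.Default as SemiringSolver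
open import Data.Fin.Base using (Fin; toℕ)
open import Data.Nat.Base as ℕ using (ℕ; zero; suc; _≤_; _<_; s≤s; _∸_)
import Data.Nat.Properties as ℕₚ
open import Data.Product.Base using (Σ-syntax; _×_; _,_; proj₁; proj₂)
open import Data.Rational.Base as ℚ using (ℚ; 0ℚ; 1ℚ)
import Data.Rational.Properties as ℚₚ
open import Data.Unit.Base using (tt)
open import Level using (Level; lift)
open import Relation.Binary.PropositionalEquality as ≡ using (_≡_; _≢_)
import Relation.Binary.Reasoning.Setoid as SetoidReasoning
open import Relation.Nullary.Negation using (¬_)
open import Defs using (module InField)

-- The expansion over an arbitrary Heyting field, starting with cancellation and division.

module Expansion {c ℓ₁ ℓ₂ : Level} (F : HeytingField c ℓ₁ ℓ₂)
                 (x y : ℕ → InField.Nonzero F) where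
  open HeytingField F hiding (zero)
  open HeytingCommutativeRing heytingCommutativeRing using (commutativeRing)
  open CommutativeRing commutativeRing using (ring; semiring; commutativeSemiring; +-group)
  open HeytingProperties heytingCommutativeRing
  open GroupProperties +-group using () renaming (∙-cancelʳ to +-cancelʳ)
  open RingProperties ring using (-1*x≈-x)
  open SemiringSum semiring using (sum; *-distribˡ-sum; sum-cong-≋)
  open SemiringExp semiring using (_^_)
  open SemiringSolver commutativeSemiring using (solve; _:+_; _:*_; _:=_)
  open SetoidReasoning setoid
  open InField F
  open Coefficients x y

  -- `v` times an inverse of `u * v` inverts `u`. Every denominator below is shown nonzero this way:
  -- some multiple of it equals an element already known to be apart from 0.
  *-#0ˡ : ∀ {u v} → u * v # 0# → u # 0#
  *-#0ˡ {u} {v} uv#0 = invertibleʳ⇒# (v * w , (begin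
    (u - 0#) * (v * w)  ≈⟨ *-congʳ (x-0≈x u) ⟩
    u * (v * w)         ≈⟨ *-assoc u v w ⟨
    u * v * w           ≈⟨ *-comm (u * v) w ⟩
    w * (u * v)         ≈⟨ *-congˡ (x-0≈x (u * v)) ⟨
    w * (u * v - 0#)    ≈⟨ proj₁ (proj₂ (#⇒invertible uv#0)) ⟩
    1#                  ∎))
    where w = proj₁ (#⇒invertible uv#0)

  ⁻¹-inverseˡ : ∀ z → ⟦ z ⁻¹ ⟧ * ⟦ z ⟧ ≈ 1#
  ⁻¹-inverseˡ z = trans (*-congˡ (sym (x-0≈x ⟦ z ⟧)))
                        (proj₁ (proj₂ (#⇒invertible (nonzero z))))

  /-cancelʳ : ∀ w z → w / z * ⟦ z ⟧ ≈ w
  /-cancelʳ w z = trans (*-assoc w _ _) (trans (*-congˡ (⁻¹-inverseˡ z)) (*-identityʳ w))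

  *-cancelˡ-#0 : ∀ {u v w} → u # 0# → u * v ≈ u * w → v ≈ w
  *-cancelˡ-#0 {u} {v} {w} u#0 e = begin
    v                ≈⟨ unfold v ⟨
    i * (u * v)      ≈⟨ *-congˡ e ⟩
    i * (u * w)      ≈⟨ unfold w ⟩
    w                ∎
    where
    i = ⟦ ⟪ u , u#0 ⟫ ⁻¹ ⟧
    unfold : ∀ t → i * (u * t) ≈ t
    unfold t = trans (sym (*-assoc i u t))
                 (trans (*-congʳ (⁻¹-inverseˡ ⟪ u , u#0 ⟫)) (*-identityˡ t))

  x-y+y≈x : ∀ u v → u - v + v ≈ u
  x-y+y≈x u v = trans (+-assoc u (- v) v) (trans (+-congˡ (-‿inverseˡ v)) (+-identityʳ u))

  -- Alternating tails and the quadratic expressions in them.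

  X Y r : ℕ → Carrier
  X k = ⟦ x k ⟧
  Y k = ⟦ y k ⟧
  r k = Y k / x k

  r-#0 : ∀ k → r k # 0#
  r-#0 k = nonzero (y k ⊘ x k)

  -- The second argument counts terms, so `S k l` ends at r with index k + l - 1. Tails with the
  -- same last index n are those whose arguments add up to n + 1.
  S : ℕ → ℕ → Carrier
  S k zero    = 0#
  S k (suc l) = r k - S (suc k) l

  -- Minus the 2 by 2 Hankel determinant of three consecutive tails, all ending at index k + p + 1.
  G : ℕ → ℕ → Carrier
  G k p = S (1 ℕ.+ k) (1 ℕ.+ p) * S (1 ℕ.+ k) (1 ℕ.+ p) - S k (2 ℕ.+ p) * S (2 ℕ.+ k) p

  -- What (b₃ₖ₋₁ + Rₖ) Gₖ becomes once Rₖ Gₖ is replaced by yₖ² Sₖ₊₂.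
  H : ℕ → ℕ → Carrier
  H k p = (X k * Y k - Y (suc k)) * G k p + Y k * Y k * S (2 ℕ.+ k) p

  -- Like `Y-S` and `G-S` below, a definition with its subtraction moved to the other side, so that
  -- the semiring solver can carry the later identities.
  S-step : ∀ k l → S k (suc l) + S (suc k) l ≈ r k
  S-step k l = x-y+y≈x _ _

  Y-S : ∀ k l → Y k ≈ (S k (suc l) + S (suc k) l) * X k
  Y-S k l = sym (trans (*-congʳ (S-step k l)) (/-cancelʳ (Y k) (x k)))

  G-S : ∀ k p → G k p + S k (2 ℕ.+ p) * S (2 ℕ.+ k) p ≈
                S (1 ℕ.+ k) (1 ℕ.+ p) * S (1 ℕ.+ k) (1 ℕ.+ p)
  G-S k p = x-y+y≈x _ _

  -- The operators θ and θ² with denominators cleared.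

  θ-* : ∀ u k → ⟦ θ u k ⟧ * ⟦ u k ⟧ ≈ ⟦ u (suc k) ⟧
  θ-* u k = /-cancelʳ ⟦ u (suc k) ⟧ (u k)

  θ²-* : ∀ u k → ⟦ θ² u k ⟧ * (⟦ u (1 ℕ.+ k) ⟧ * ⟦ u (1 ℕ.+ k) ⟧) ≈ ⟦ u (2 ℕ.+ k) ⟧ * ⟦ u k ⟧
  θ²-* u k = begin
    t * (u₁ * u₁)                ≈⟨ *-congˡ (*-congʳ (θ-* u k)) ⟨
    t * (t₀ * u₀ * u₁)
      ≈⟨ solve 4 (λ t t₀ u₀ u₁ → t :* (t₀ :* u₀ :* u₁) := t :* t₀ :* u₁ :* u₀) refl t t₀ u₀ u₁ ⟩
    t * t₀ * u₁ * u₀             ≈⟨ *-congʳ (*-congʳ (θ-* (θ u) k)) ⟩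
    ⟦ θ u (suc k) ⟧ * u₁ * u₀    ≈⟨ *-congʳ (θ-* u (suc k)) ⟩
    ⟦ u (2 ℕ.+ k) ⟧ * u₀         ∎
    where
    t = ⟦ θ² u k ⟧
    t₀ = ⟦ θ u k ⟧
    u₀ = ⟦ u k ⟧
    u₁ = ⟦ u (suc k) ⟧

  -- Peeling off the first term shifts both the summand and `k`, so the induction runs over every
  -- `f` that agrees with `r` shifted by `k`.
  sum-S : ∀ n k (f : ℕ → Carrier) → (∀ i → f i ≡ r (k ℕ.+ i)) →
          sum {n} (λ i → (- 1#) ^ toℕ i * f (toℕ i)) ≈ S k n
  sum-S zero    k f f≡r = refl
  sum-S (suc n) k f f≡r = +-cong
    (trans (*-identityˡ (f 0)) (reflexive (≡.trans (f≡r 0) (≡.cong r (ℕₚ.+-identityʳ k)))))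
    (begin
      sum (λ (i : Fin n) → - 1# * (- 1#) ^ toℕ i * f (suc (toℕ i)))
        ≈⟨ sum-cong-≋ (λ (i : Fin n) → *-assoc (- 1#) ((- 1#) ^ toℕ i) (f (suc (toℕ i)))) ⟩
      sum (λ (i : Fin n) → - 1# * ((- 1#) ^ toℕ i * f (suc (toℕ i))))
        ≈⟨ *-distribˡ-sum {n} (- 1#) _ ⟨
      - 1# * sum {n} (λ i → (- 1#) ^ toℕ i * f (suc (toℕ i)))
        ≈⟨ *-congˡ (sum-S n (suc k) (λ i → f (suc i))
             (λ i → ≡.trans (f≡r (suc i)) (≡.cong r (ℕₚ.+-suc k i)))) ⟩
      - 1# * S (suc k) n
        ≈⟨ -1*x≈-x (S (suc k) n) ⟩
      - S (suc k) n ∎)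

  -- Each period of three is absorbed into `k` by the last clause of `aFrom`; the rewrites expose
  -- its three successors. This identifies the coefficients at the variable indices met in `tail`.
  aFrom-shift : ∀ j t k → aFrom (j ℕ.+ t ℕ.* 3) k ≡ aFrom j (k ℕ.+ t)
  aFrom-shift j zero k rewrite ℕₚ.+-identityʳ j | ℕₚ.+-identityʳ k = ≡.refl
  aFrom-shift j (suc t) k
    rewrite ℕₚ.+-suc j (2 ℕ.+ t ℕ.* 3) | ℕₚ.+-suc j (1 ℕ.+ t ℕ.* 3)
          | ℕₚ.+-suc j (t ℕ.* 3) | ℕₚ.+-suc k t = aFrom-shift j t (suc k)

  bFrom-shift : ∀ j t k → bFrom (j ℕ.+ t ℕ.* 3) k ≡ bFrom j (k ℕ.+ t)
  bFrom-shift j zero k rewrite ℕₚ.+-identityʳ j | ℕₚ.+-identityʳ k = ≡.refl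
  bFrom-shift j (suc t) k
    rewrite ℕₚ.+-suc j (2 ℕ.+ t ℕ.* 3) | ℕₚ.+-suc j (1 ℕ.+ t ℕ.* 3)
          | ℕₚ.+-suc j (t ℕ.* 3) | ℕₚ.+-suc k t = bFrom-shift j t (suc k)

  -- z is the reciprocal by which b₃ₖ is increased; w stands for 1 − z, which keeps
  -- the identities free of subtraction, hence within reach of the semiring solver.
  θ²-difference : ∀ k p {z w} → z + w ≈ 1# →
    w * (X (1 ℕ.+ k) * Y (1 ℕ.+ k) * S (2 ℕ.+ k) (suc p)) ≈ X (2 ℕ.+ k) * G (1 ℕ.+ k) p →
    ((⟦ θ² x k ⟧ - ⟦ θ² y k ⟧) / x k - 1# + z)
      * (S (2 ℕ.+ k) (suc p) * (Y (1 ℕ.+ k) * Y (1 ℕ.+ k)))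
      ≈ Y (2 ℕ.+ k) * G k (suc p)
  -- Adding `w + β` turns the factor `D` into `α`: the sum z + w absorbs the -1, and `β` restores
  -- the subtracted quotient.
  θ²-difference k p {z} {w} z+w≈1 w-eq = +-cancelʳ ((w + β) * (s₂ * (y₁ * y₁))) _ _ (begin
    D * (s₂ * (y₁ * y₁)) + (w + β) * (s₂ * (y₁ * y₁))
      ≈⟨ distribʳ _ D (w + β) ⟨
    (D + (w + β)) * (s₂ * (y₁ * y₁))
      ≈⟨ *-congʳ (trans (sym (+-assoc D w β)) (D+w+β≈α)) ⟩
    α * (s₂ * (y₁ * y₁))
      ≈⟨ *-congˡ (*-congˡ (*-cong Y₁ Y₁)) ⟩
    α * (s₂ * ((s₁ + s₂) * x₁ * ((s₁ + s₂) * x₁)))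
      ≈⟨ solve 4 (λ α s₁ s₂ x₁ → α :* (s₂ :* ((s₁ :+ s₂) :* x₁ :* ((s₁ :+ s₂) :* x₁)))
           := α :* (x₁ :* x₁) :* ((s₁ :+ s₂) :* (s₁ :* s₂ :+ s₂ :* s₂))) refl α s₁ s₂ x₁ ⟩
    α * (x₁ * x₁) * ((s₁ + s₂) * (s₁ * s₂ + s₂ * s₂))
      -- The two determinant relations are used in turn: s₂² becomes g′ + s₁ s₃, the common product
      -- s₁ (s₁ + s₂) (s₂ + s₃) is regrouped, and s₁² becomes g + s₀ s₂.
      ≈⟨ *-cong αx₁x₁≈x₂ (*-congˡ (+-congˡ (sym (G-S (1 ℕ.+ k) p)))) ⟩
    x₂ * ((s₁ + s₂) * (s₁ * s₂ + (g′ + s₁ * s₃)))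
      ≈⟨ solve 5 (λ x s₁ s₂ s₃ g′ → x :* ((s₁ :+ s₂) :* (s₁ :* s₂ :+ (g′ :+ s₁ :* s₃)))
           := x :* ((s₂ :+ s₃) :* (s₁ :* s₁ :+ s₁ :* s₂) :+ (s₁ :+ s₂) :* g′))
           refl x₂ s₁ s₂ s₃ g′ ⟩
    x₂ * ((s₂ + s₃) * (s₁ * s₁ + s₁ * s₂) + (s₁ + s₂) * g′)
      ≈⟨ *-congˡ (+-congʳ (*-congˡ (+-congʳ (sym (G-S k (suc p)))))) ⟩
    x₂ * ((s₂ + s₃) * (g + s₀ * s₂ + s₁ * s₂) + (s₁ + s₂) * g′)
      ≈⟨ solve 7 (λ x s₀ s₁ s₂ s₃ g g′ →
           x :* ((s₂ :+ s₃) :* (g :+ s₀ :* s₂ :+ s₁ :* s₂) :+ (s₁ :+ s₂) :* g′)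
           := (s₂ :+ s₃) :* x :* g :+ ((s₁ :+ s₂) :* (x :* g′) :+ (s₂ :+ s₃) :* x :* (s₀ :+ s₁) :* s₂))
           refl x₂ s₀ s₁ s₂ s₃ g g′ ⟩
    (s₂ + s₃) * x₂ * g + ((s₁ + s₂) * (x₂ * g′) + (s₂ + s₃) * x₂ * (s₀ + s₁) * s₂)
      ≈⟨ +-cong (*-congʳ (sym Y₂)) (+-cong (*-congˡ (sym w-eq))
          (*-congʳ (*-cong (sym Y₂) (S-step k (2 ℕ.+ p))))) ⟩
    y₂ * g + ((s₁ + s₂) * (w * (x₁ * y₁ * s₂)) + y₂ * r k * s₂)
      ≈⟨ +-congˡ (+-congˡ (*-congʳ βy₁y₁≈y₂r₀)) ⟨
    y₂ * g + ((s₁ + s₂) * (w * (x₁ * y₁ * s₂)) + β * (y₁ * y₁) * s₂)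
      ≈⟨ +-congˡ (+-congʳ (solve 5 (λ s₁ s₂ w x₁ y₁ → (s₁ :+ s₂) :* (w :* (x₁ :* y₁ :* s₂))
           := w :* s₂ :* y₁ :* ((s₁ :+ s₂) :* x₁)) refl s₁ s₂ w x₁ y₁)) ⟩
    y₂ * g + (w * s₂ * y₁ * ((s₁ + s₂) * x₁) + β * (y₁ * y₁) * s₂)
      ≈⟨ +-congˡ (+-congʳ (*-congˡ Y₁)) ⟨
    y₂ * g + (w * s₂ * y₁ * y₁ + β * (y₁ * y₁) * s₂)
      ≈⟨ +-congˡ (solve 4 (λ w s₂ y₁ β → w :* s₂ :* y₁ :* y₁ :+ β :* (y₁ :* y₁) :* s₂
           := (w :+ β) :* (s₂ :* (y₁ :* y₁))) refl w s₂ y₁ β) ⟩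
    y₂ * g + (w + β) * (s₂ * (y₁ * y₁)) ∎)
    where
    x₀ = X k
    x₁ = X (1 ℕ.+ k)
    x₂ = X (2 ℕ.+ k)
    y₁ = Y (1 ℕ.+ k)
    y₂ = Y (2 ℕ.+ k)
    s₀ = S k (3 ℕ.+ p)
    s₁ = S (1 ℕ.+ k) (2 ℕ.+ p)
    s₂ = S (2 ℕ.+ k) (1 ℕ.+ p)
    s₃ = S (3 ℕ.+ k) p
    g  = G k (suc p)
    g′ = G (suc k) p
    α  = ⟦ θ² x k ⟧ / x k
    β  = ⟦ θ² y k ⟧ / x k
    q  = (⟦ θ² x k ⟧ - ⟦ θ² y k ⟧) / x k
    D  = q - 1# + z
    Y₁ = Y-S (1 ℕ.+ k) (1 ℕ.+ p)
    Y₂ = Y-S (2 ℕ.+ k) p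

    D+w+β≈α : D + w + β ≈ α
    D+w+β≈α = begin
      q - 1# + z + w + β     ≈⟨ +-congʳ (trans (+-assoc _ z w) (+-congˡ z+w≈1)) ⟩
      q - 1# + 1# + β        ≈⟨ +-congʳ (x-y+y≈x q 1#) ⟩
      q + β                  ≈⟨ distribʳ ⟦ x k ⁻¹ ⟧ _ _ ⟨
      (⟦ θ² x k ⟧ - ⟦ θ² y k ⟧ + ⟦ θ² y k ⟧) / x k ≈⟨ *-congʳ (x-y+y≈x _ _) ⟩
      α                      ∎

    αx₁x₁≈x₂ : α * (x₁ * x₁) ≈ x₂
    αx₁x₁≈x₂ = begin
      ⟦ θ² x k ⟧ / x k * (x₁ * x₁)
        ≈⟨ solve 3 (λ a b c → a :* b :* c := a :* c :* b) refl ⟦ θ² x k ⟧ ⟦ x k ⁻¹ ⟧ (x₁ * x₁) ⟩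
      ⟦ θ² x k ⟧ * (x₁ * x₁) / x k    ≈⟨ *-congʳ (θ²-* x k) ⟩
      x₂ * x₀ * ⟦ x k ⁻¹ ⟧
        ≈⟨ solve 3 (λ a b c → a :* b :* c := a :* c :* b) refl x₂ x₀ ⟦ x k ⁻¹ ⟧ ⟩
      x₂ / x k * x₀                   ≈⟨ /-cancelʳ x₂ (x k) ⟩
      x₂                              ∎

    βy₁y₁≈y₂r₀ : β * (y₁ * y₁) ≈ y₂ * r k
    βy₁y₁≈y₂r₀ = begin
      ⟦ θ² y k ⟧ / x k * (y₁ * y₁)
        ≈⟨ solve 3 (λ a b c → a :* b :* c := a :* c :* b) refl ⟦ θ² y k ⟧ ⟦ x k ⁻¹ ⟧ (y₁ * y₁) ⟩
      ⟦ θ² y k ⟧ * (y₁ * y₁) / x k    ≈⟨ *-congʳ (θ²-* y k) ⟩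
      y₂ * Y k / x k                  ≈⟨ *-assoc y₂ (Y k) _ ⟩
      y₂ * r k                        ∎

  -- Evaluation of the continued fraction from the innermost quotient outwards, given that `S`, `G`
  -- and `H` do not vanish.

  module _
    (S-#0 : ∀ k l → S (suc k) (suc l) # 0#)
    (G-#0 : ∀ k p → G (suc k) p # 0#)
    (H-#0 : ∀ k p → H (suc k) p # 0#)
    where

    -- Treats the denominators `B` and `C` at indices 3K - 1 and 3K - 2, above a part `R` starting
    -- at index 3K. They are nonzero because B G = H and C B G is a product of terms x, y, S and r.
    -- The coefficients enter through equations since at variable indices they reduce only after a
    -- shift.
    unit-quotient : ∀ k p R {b₂ a₂ b₁} → let K = suc k in
      b₂ ≡ X K * Y K - Y (suc K) → a₂ ≡ Y (suc K) → b₁ ≡ 1# →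
      R * G K p ≈ Y K * Y K * S (2 ℕ.+ K) p →
      Σ[ B#0 ∈ b₂ + R # 0# ] Σ[ C#0 ∈ b₁ + a₂ / ⟪ b₂ + R , B#0 ⟫ # 0# ] Σ[ w ∈ Carrier ]
        ⟦ ⟪ _ , C#0 ⟫ ⁻¹ ⟧ + w ≈ 1# ×
        w * (X K * Y K * S (suc K) (suc p)) ≈ X (suc K) * G K p
    -- Multiplication by `r (suc K)` completes the left side to w C B G; in w = z c′ the factor z
    -- then cancels C, and c′ B is y with index K + 1.
    unit-quotient k p R ≡.refl ≡.refl ≡.refl inv = B#0 , C#0 , w , z+w≈1 , *-cancelˡ-#0 (r-#0 (suc K)) (begin
      r (suc K) * (w * (x₁ * y₁ * s₂))
        ≈⟨ *-congʳ (S-step (suc K) p) ⟨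
      (s₂ + s₃) * (w * (x₁ * y₁ * s₂))
        ≈⟨ solve 5 (λ s₂ s₃ w x₁ y₁ → (s₂ :+ s₃) :* (w :* (x₁ :* y₁ :* s₂))
             := w :* (x₁ :* y₁ :* s₂ :* (s₂ :+ s₃))) refl s₂ s₃ w x₁ y₁ ⟩
      w * (x₁ * y₁ * s₂ * (s₂ + s₃))
        ≈⟨ *-congˡ CBg≈ ⟨
      z * c′ * (C * (B * g))
        ≈⟨ solve 5 (λ z c C B g → z :* c :* (C :* (B :* g)) := z :* C :* (c :* B :* g)) refl z c′ C B g ⟩
      z * C * (c′ * B * g)
        ≈⟨ *-cong (⁻¹-inverseˡ ⟪ C , C#0 ⟫) (*-congʳ cB≈y₂) ⟩
      1# * (y₂ * g)
        ≈⟨ *-identityˡ _ ⟩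
      y₂ * g
        ≈⟨ *-congʳ (/-cancelʳ y₂ (x (suc K))) ⟨
      r (suc K) * x₂ * g
        ≈⟨ *-assoc (r (suc K)) x₂ g ⟩
      r (suc K) * (x₂ * g) ∎)
      where
      K = suc k
      x₁ = X K
      y₁ = Y K
      x₂ = X (suc K)
      y₂ = Y (suc K)
      s₁ = S K (2 ℕ.+ p)
      s₂ = S (1 ℕ.+ K) (1 ℕ.+ p)
      s₃ = S (2 ℕ.+ K) p
      g = G K p
      b₂ = x₁ * y₁ - y₂
      B = b₂ + R

      Bg≈H : B * g ≈ H K p
      Bg≈H = trans (distribʳ g b₂ R) (+-congˡ inv)

      B#0 : B # 0#
      B#0 = *-#0ˡ (#-congʳ (sym Bg≈H) (H-#0 k p))

      c′ = y₂ / ⟪ B , B#0 ⟫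
      C = 1# + c′

      cB≈y₂ : c′ * B ≈ y₂
      cB≈y₂ = /-cancelʳ y₂ ⟪ B , B#0 ⟫

      CBg≈ : C * (B * g) ≈ x₁ * y₁ * s₂ * (s₂ + s₃)
      CBg≈ = begin
        C * (B * g)
          ≈⟨ trans (distribʳ (B * g) 1# c′) (+-cong (*-identityˡ _) (sym (*-assoc c′ B g))) ⟩
        B * g + c′ * B * g
          ≈⟨ +-congˡ (*-congʳ cB≈y₂) ⟩
        (b₂ + R) * g + y₂ * g
          ≈⟨ solve 4 (λ b R g y → (b :+ R) :* g :+ y :* g := (b :+ y) :* g :+ R :* g) refl b₂ R g y₂ ⟩
        (b₂ + y₂) * g + R * g
          ≈⟨ +-cong (*-congʳ (x-y+y≈x _ _)) inv ⟩
        x₁ * y₁ * g + y₁ * y₁ * s₃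
          ≈⟨ +-congˡ (*-congʳ (*-congʳ (Y-S K (suc p)))) ⟩
        x₁ * y₁ * g + (s₁ + s₂) * x₁ * y₁ * s₃
          ≈⟨ solve 6 (λ x y g s₁ s₂ s₃ → x :* y :* g :+ (s₁ :+ s₂) :* x :* y :* s₃
               := x :* y :* (g :+ s₁ :* s₃ :+ s₂ :* s₃)) refl x₁ y₁ g s₁ s₂ s₃ ⟩
        x₁ * y₁ * (g + s₁ * s₃ + s₂ * s₃)
          ≈⟨ *-congˡ (+-congʳ (G-S K p)) ⟩
        x₁ * y₁ * (s₂ * s₂ + s₂ * s₃)
          ≈⟨ solve 4 (λ x y s₂ s₃ → x :* y :* (s₂ :* s₂ :+ s₂ :* s₃)
               := x :* y :* s₂ :* (s₂ :+ s₃)) refl x₁ y₁ s₂ s₃ ⟩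
        x₁ * y₁ * s₂ * (s₂ + s₃) ∎

      C#0 : C # 0#
      C#0 = *-#0ˡ (#-congʳ (sym (trans CBg≈ (*-congˡ (S-step (suc K) p))))
              (x#0y#0→xy#0 (x#0y#0→xy#0 (x#0y#0→xy#0 (nonzero (x K)) (nonzero (y K))) (S-#0 K p))
                (r-#0 (suc K))))

      z = ⟦ ⟪ C , C#0 ⟫ ⁻¹ ⟧
      w = z * c′

      z+w≈1 : z + w ≈ 1#
      z+w≈1 = begin
        z + z * c′       ≈⟨ +-congʳ (*-identityʳ z) ⟨
        z * 1# + z * c′  ≈⟨ distribˡ z 1# c′ ⟨
        z * C            ≈⟨ ⁻¹-inverseˡ ⟪ C , C#0 ⟫ ⟩
        1#               ∎

    -- Closes a period: `a₀ * z` is the quotient at index 3K + 1. `θ²-difference` evaluates `D`, and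
    -- the relation for θ² y then leaves a common factor y with index K + 2 to cancel.
    tail-step : ∀ k p {z w b₁ a₁ a₀} → let K = suc k in
      b₁ ≡ (⟦ θ² x K ⟧ - ⟦ θ² y K ⟧) / x K - 1# → a₁ ≡ Y K * ⟦ θ² y K ⟧ → a₀ ≡ 1# →
      z + w ≈ 1# →
      w * (X (1 ℕ.+ K) * Y (1 ℕ.+ K) * S (2 ℕ.+ K) (suc p)) ≈ X (2 ℕ.+ K) * G (1 ℕ.+ K) p →
      Σ[ D#0 ∈ b₁ + a₀ * z # 0# ]
        a₁ / ⟪ b₁ + a₀ * z , D#0 ⟫ * G K (suc p) ≈ Y K * Y K * S (2 ℕ.+ K) (suc p)
    tail-step k p {z} ≡.refl ≡.refl ≡.refl z+w≈1 w-eq =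
      D#0 , *-cancelˡ-#0 (nonzero (y (2 ℕ.+ K))) (begin
        y₂ * (R * g)                  ≈⟨ solve 3 (λ y R g → y :* (R :* g) := R :* (y :* g)) refl y₂ R g ⟩
        R * (y₂ * g)                  ≈⟨ *-congˡ Ds₂y₁y₁≈y₂g ⟨
        R * (D * (s₂ * (y₁ * y₁)))    ≈⟨ *-assoc R D _ ⟨
        R * D * (s₂ * (y₁ * y₁))      ≈⟨ *-congʳ (/-cancelʳ _ ⟪ D , D#0 ⟫) ⟩
        y₀ * t * (s₂ * (y₁ * y₁))
          ≈⟨ solve 4 (λ y₀ t s y₁ → y₀ :* t :* (s :* (y₁ :* y₁))
               := y₀ :* s :* (t :* (y₁ :* y₁))) refl y₀ t s₂ y₁ ⟩
        y₀ * s₂ * (t * (y₁ * y₁))     ≈⟨ *-congˡ (θ²-* y K) ⟩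
        y₀ * s₂ * (y₂ * y₀)
          ≈⟨ solve 3 (λ y₀ s₂ y₂ → y₀ :* s₂ :* (y₂ :* y₀) := y₂ :* (y₀ :* y₀ :* s₂)) refl y₀ s₂ y₂ ⟩
        y₂ * (y₀ * y₀ * s₂)           ∎)
      where
      K  = suc k
      y₀ = Y K
      y₁ = Y (1 ℕ.+ K)
      y₂ = Y (2 ℕ.+ K)
      s₂ = S (2 ℕ.+ K) (suc p)
      g  = G K (suc p)
      t  = ⟦ θ² y K ⟧
      D  = (⟦ θ² x K ⟧ - ⟦ θ² y K ⟧) / x K - 1# + 1# * z

      Ds₂y₁y₁≈y₂g : D * (s₂ * (y₁ * y₁)) ≈ y₂ * g
      Ds₂y₁y₁≈y₂g = trans (*-congʳ (+-congˡ (*-identityˡ z))) (θ²-difference K p z+w≈1 w-eq)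

      D#0 : D # 0#
      D#0 = *-#0ˡ (#-congʳ (sym Ds₂y₁y₁≈y₂g) (x#0y#0→xy#0 (nonzero (y (2 ℕ.+ K))) (G-#0 k (suc p))))

      R = y₀ * t / ⟪ D , D#0 ⟫

    -- Put k = 2 + t and n = k + 1 + p: the part starts at index 3k and its 3p quotients end at 3n -
    -- 4. Lowering `p` raises k with n fixed. At p = 0 both the continued fraction and the last tail
    -- are empty.
    tail : ∀ p t → Σ[ d ∈ Defined a b (6 ℕ.+ t ℕ.* 3) (p ℕ.* 3) ]
           value a b (6 ℕ.+ t ℕ.* 3) (p ℕ.* 3) d * G (2 ℕ.+ t) p
             ≈ Y (2 ℕ.+ t) * Y (2 ℕ.+ t) * S (4 ℕ.+ t) p
    tail zero    t = lift tt , trans (zeroˡ _) (sym (zeroʳ _))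
    tail (suc p) t =
      let d , inv                       = tail p (suc t)
          -- A period straddles two values of k: indices 3k + 2 and 3k + 1 are handled with K = k +
          -- 1, while the unit denominator is listed under k itself.
          B#0 , C#0 , w , z+w≈1 , w-eq  = unit-quotient (2 ℕ.+ t) p _ (bFrom-shift 0 (suc t) 2)
                                            (aFrom-shift 0 (suc t) 2) (bFrom-shift 2 t 2) inv
          D#0 , inv′                    = tail-step (1 ℕ.+ t) p (bFrom-shift 1 t 2)
                                            (aFrom-shift 1 t 2) (aFrom-shift 2 t 2) z+w≈1 w-eq
      in (((d , B#0) , C#0) , D#0) , inv′

    -- The irregular denominator at index 3 is x₁ times what the general pattern would give for k =
    -- 1, plus θ² y₁ (see `D≈`), so `θ²-difference` applies to it too.
    third-quotient : ∀ p {z w} → z + w ≈ 1# →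
      w * (X 2 * Y 2 * S 3 (suc p)) ≈ X 3 * G 2 p →
      Σ[ D#0 ∈ b 3 + X 1 * z # 0# ]
        a 3 / ⟪ b 3 + X 1 * z , D#0 ⟫ * (X 1 * S 2 (2 ℕ.+ p)) ≈ X 2 * S 3 (1 ℕ.+ p)
    third-quotient p {z} {w} z+w≈1 w-eq =
      D#0 , *-cancelˡ-#0 (x#0y#0→xy#0 (nonzero (y 3)) (r-#0 2)) (begin
        y₃ * r 2 * (V * (x₁ * s₂))
          ≈⟨ solve 5 (λ y r V x s → y :* r :* (V :* (x :* s))
               := V :* (x :* y :* (s :* r))) refl y₃ (r 2) V x₁ s₂ ⟩
        V * (x₁ * y₃ * (s₂ * r 2))      ≈⟨ *-congˡ Ds₃y₂y₂≈ ⟨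
        V * (D * (s₃ * (y₂ * y₂)))      ≈⟨ *-assoc V D _ ⟨
        V * D * (s₃ * (y₂ * y₂))        ≈⟨ *-congʳ (/-cancelʳ _ ⟪ D , D#0 ⟫) ⟩
        ⟦ θ y 2 ⟧ * (s₃ * (y₂ * y₂))
          ≈⟨ solve 3 (λ t s y → t :* (s :* (y :* y)) := t :* y :* (s :* y)) refl ⟦ θ y 2 ⟧ s₃ y₂ ⟩
        ⟦ θ y 2 ⟧ * y₂ * (s₃ * y₂)      ≈⟨ *-cong (θ-* y 2) (*-congˡ (sym (/-cancelʳ y₂ (x 2)))) ⟩
        y₃ * (s₃ * (r 2 * x₂))
          ≈⟨ solve 4 (λ y s r x → y :* (s :* (r :* x)) := y :* r :* (x :* s)) refl y₃ s₃ (r 2) x₂ ⟩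
        y₃ * r 2 * (x₂ * s₃)            ∎)
      where
      x₁ = X 1
      x₂ = X 2
      y₁ = Y 1
      y₂ = Y 2
      y₃ = Y 3
      s₁ = S 1 (3 ℕ.+ p)
      s₂ = S 2 (2 ℕ.+ p)
      s₃ = S 3 (1 ℕ.+ p)
      g  = G 1 (suc p)
      t  = ⟦ θ² y 1 ⟧
      q  = (⟦ θ² x 1 ⟧ - t) / x 1
      D  = ⟦ θ² x 1 ⟧ - x₁ + x₁ * z

      D≈ : D ≈ x₁ * (q - 1# + z) + t
      D≈ = sym (begin
        x₁ * (q - 1# + z) + t
          ≈⟨ solve 5 (λ x q m z t → x :* (q :+ m :+ z) :+ t
               := q :* x :+ t :+ x :* m :+ x :* z) refl x₁ q (- 1#) z t ⟩
        q * x₁ + t + x₁ * - 1# + x₁ * z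
          ≈⟨ +-congʳ (+-cong (trans (+-congʳ (/-cancelʳ _ (x 1))) (x-y+y≈x _ t))
               (trans (*-comm x₁ (- 1#)) (-1*x≈-x x₁))) ⟩
        D ∎)

      Ds₃y₂y₂≈ : D * (s₃ * (y₂ * y₂)) ≈ x₁ * y₃ * (s₂ * r 2)
      Ds₃y₂y₂≈ = begin
        D * (s₃ * (y₂ * y₂))
          ≈⟨ *-congʳ D≈ ⟩
        (x₁ * (q - 1# + z) + t) * (s₃ * (y₂ * y₂))
          ≈⟨ solve 5 (λ x e t s y → (x :* e :+ t) :* (s :* (y :* y))
               := x :* (e :* (s :* (y :* y))) :+ t :* (y :* y) :* s) refl x₁ (q - 1# + z) t s₃ y₂ ⟩
        x₁ * ((q - 1# + z) * (s₃ * (y₂ * y₂))) + t * (y₂ * y₂) * s₃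
          ≈⟨ +-cong (*-congˡ (θ²-difference 1 p z+w≈1 w-eq))
               (*-congʳ (trans (θ²-* y 1) (*-congˡ (Y-S 1 (2 ℕ.+ p))))) ⟩
        x₁ * (y₃ * g) + y₃ * ((s₁ + s₂) * x₁) * s₃
          ≈⟨ solve 6 (λ x y g s₁ s₂ s₃ → x :* (y :* g) :+ y :* ((s₁ :+ s₂) :* x) :* s₃
               := x :* y :* (g :+ s₁ :* s₃ :+ s₂ :* s₃)) refl x₁ y₃ g s₁ s₂ s₃ ⟩
        x₁ * y₃ * (g + s₁ * s₃ + s₂ * s₃)
          ≈⟨ *-congˡ (+-congʳ (G-S 1 (suc p))) ⟩
        x₁ * y₃ * (s₂ * s₂ + s₂ * s₃)
          ≈⟨ *-congˡ (trans (sym (distribˡ s₂ s₂ s₃)) (*-congˡ (S-step 2 (suc p)))) ⟩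
        x₁ * y₃ * (s₂ * r 2) ∎

      D#0 : D # 0#
      D#0 = *-#0ˡ (#-congʳ (sym Ds₃y₂y₂≈) (x#0y#0→xy#0 (x#0y#0→xy#0 (nonzero (x 1)) (nonzero (y 3)))
              (x#0y#0→xy#0 (S-#0 1 (suc p)) (r-#0 2))))

      V = ⟦ θ y 2 ⟧ / ⟪ D , D#0 ⟫

    -- The outer denominators collapse in turn: W y₁ S₂ = y₂ S₁, then (a₂ / W) S₁ = x₁ y₁ S₂, then Q
    -- S₁ = x₁ y₁ (S₁ + S₂) = y₁². Keeping `V` abstract also covers n = 2.
    first-quotients : ∀ q V → V * (X 1 * S 2 (1 ℕ.+ q)) ≈ X 2 * S 3 q →
      Σ[ W#0 ∈ b 2 + V # 0# ] Σ[ Q#0 ∈ b 1 + a 2 / ⟪ b 2 + V , W#0 ⟫ # 0# ]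
        S 1 (2 ℕ.+ q) ≈ a 1 / ⟪ b 1 + a 2 / ⟪ b 2 + V , W#0 ⟫ , Q#0 ⟫
    first-quotients q V V-eq = W#0 , Q#0 , *-cancelˡ-#0 y₁²#0 (begin
        y₁ * y₁ * s₁                    ≈⟨ *-congʳ (*-congˡ (*-identityʳ y₁)) ⟨
        y₁ ^ 2 * s₁                     ≈⟨ *-congʳ (/-cancelʳ (y₁ ^ 2) ⟪ Q , Q#0 ⟫) ⟨
        y₁ ^ 2 / ⟪ Q , Q#0 ⟫ * Q * s₁   ≈⟨ *-assoc _ Q s₁ ⟩
        y₁ ^ 2 / ⟪ Q , Q#0 ⟫ * (Q * s₁) ≈⟨ *-congˡ Qs₁≈y₁² ⟩
        y₁ ^ 2 / ⟪ Q , Q#0 ⟫ * (y₁ * y₁) ≈⟨ *-comm _ _ ⟩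
        y₁ * y₁ * (y₁ ^ 2 / ⟪ Q , Q#0 ⟫) ∎)
      where
      x₁ = X 1
      x₂ = X 2
      y₁ = Y 1
      y₂ = Y 2
      s₁ = S 1 (2 ℕ.+ q)
      s₂ = S 2 (1 ℕ.+ q)
      s₃ = S 3 q
      tx = ⟦ θ x 1 ⟧
      ty = ⟦ θ y 1 ⟧
      W  = tx - ty + V

      y₁²#0 : y₁ * y₁ # 0#
      y₁²#0 = x#0y#0→xy#0 (nonzero (y 1)) (nonzero (y 1))

      Wy₁s₂≈y₂s₁ : W * (y₁ * s₂) ≈ y₂ * s₁
      Wy₁s₂≈y₂s₁ = *-cancelˡ-#0 (nonzero (x 1)) (+-cancelʳ (ty * y₁ * x₁ * s₂) _ _ (begin
        x₁ * (W * (y₁ * s₂)) + ty * y₁ * x₁ * s₂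
          ≈⟨ solve 6 (λ x d V y s ty → x :* ((d :+ V) :* (y :* s)) :+ ty :* y :* x :* s
               := (d :+ ty) :* x :* (y :* s) :+ y :* (V :* (x :* s))) refl x₁ (tx - ty) V y₁ s₂ ty ⟩
        (tx - ty + ty) * x₁ * (y₁ * s₂) + y₁ * (V * (x₁ * s₂))
          ≈⟨ +-cong (*-congʳ (trans (*-congʳ (x-y+y≈x tx ty)) (θ-* x 1))) (*-congˡ V-eq) ⟩
        x₂ * (y₁ * s₂) + y₁ * (x₂ * s₃)
          ≈⟨ solve 4 (λ x y s₂ s₃ → x :* (y :* s₂) :+ y :* (x :* s₃)
               := (s₂ :+ s₃) :* x :* y) refl x₂ y₁ s₂ s₃ ⟩
        (s₂ + s₃) * x₂ * y₁
          ≈⟨ *-cong (sym (Y-S 2 q)) (Y-S 1 (suc q)) ⟩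
        y₂ * ((s₁ + s₂) * x₁)
          ≈⟨ solve 4 (λ x y s₁ s₂ → y :* ((s₁ :+ s₂) :* x)
               := x :* (y :* s₁) :+ y :* x :* s₂) refl x₁ y₂ s₁ s₂ ⟩
        x₁ * (y₂ * s₁) + y₂ * x₁ * s₂
          ≈⟨ +-congˡ (*-congʳ (*-congʳ (θ-* y 1))) ⟨
        x₁ * (y₂ * s₁) + ty * y₁ * x₁ * s₂ ∎))

      W#0 : W # 0#
      W#0 = *-#0ˡ (#-congʳ (sym Wy₁s₂≈y₂s₁) (x#0y#0→xy#0 (nonzero (y 2)) (S-#0 0 (suc q))))

      U = x₁ * y₂ / ⟪ W , W#0 ⟫
      Q = x₁ * y₁ + U

      Us₁≈x₁y₁s₂ : U * s₁ ≈ x₁ * y₁ * s₂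
      Us₁≈x₁y₁s₂ = *-cancelˡ-#0 (nonzero (y 2)) (begin
        y₂ * (U * s₁)          ≈⟨ solve 3 (λ y U s → y :* (U :* s) := U :* (y :* s)) refl y₂ U s₁ ⟩
        U * (y₂ * s₁)          ≈⟨ *-congˡ Wy₁s₂≈y₂s₁ ⟨
        U * (W * (y₁ * s₂))    ≈⟨ *-assoc U W _ ⟨
        U * W * (y₁ * s₂)      ≈⟨ *-congʳ (/-cancelʳ _ ⟪ W , W#0 ⟫) ⟩
        x₁ * y₂ * (y₁ * s₂)
          ≈⟨ solve 4 (λ x y₁ y₂ s → x :* y₂ :* (y₁ :* s) := y₂ :* (x :* y₁ :* s)) refl x₁ y₁ y₂ s₂ ⟩
        y₂ * (x₁ * y₁ * s₂)    ∎)

      Qs₁≈y₁² : Q * s₁ ≈ y₁ * y₁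
      Qs₁≈y₁² = begin
        Q * s₁                          ≈⟨ distribʳ s₁ (x₁ * y₁) U ⟩
        x₁ * y₁ * s₁ + U * s₁           ≈⟨ +-congˡ Us₁≈x₁y₁s₂ ⟩
        x₁ * y₁ * s₁ + x₁ * y₁ * s₂
          ≈⟨ solve 4 (λ x y s₁ s₂ → x :* y :* s₁ :+ x :* y :* s₂
               := (s₁ :+ s₂) :* x :* y) refl x₁ y₁ s₁ s₂ ⟩
        (s₁ + s₂) * x₁ * y₁             ≈⟨ *-congʳ (Y-S 1 (suc q)) ⟨
        y₁ * y₁                         ∎

      Q#0 : Q # 0#
      Q#0 = *-#0ˡ (#-congʳ (sym Qs₁≈y₁²) y₁²#0)

    alternatingSum≈value : ∀ n → 2 ≤ n →
      Σ[ d ∈ Defined a b 1 (3 ℕ.* n ∸ 4) ] alternatingSum x y n ≈ value a b 1 (3 ℕ.* n ∸ 4) d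
    alternatingSum≈value 1 (s≤s ())
    -- With only two quotients, `V` is the empty continued fraction 0 and S₃ is an empty sum.
    alternatingSum≈value 2 _ =
      let W#0 , Q#0 , e = first-quotients 0 0# (trans (zeroˡ _) (sym (zeroʳ _)))
      in ((lift tt , W#0) , Q#0) , trans (sum-S 2 1 (λ i → r (suc i)) (λ _ → ≡.refl)) e
    alternatingSum≈value (suc (suc (suc p))) _ =
      -- With the product commuted, the length reduces to 5 + p * 3, which exposes five quotients
      -- above `tail p 0`.
      ≡.subst (λ m → Σ[ d ∈ Defined a b 1 m ] alternatingSum x y (3 ℕ.+ p) ≈ value a b 1 m d)
        (≡.cong (_∸ 4) (ℕₚ.*-comm (3 ℕ.+ p) 3))
        (let d , inv                       = tail p 0
             B#0 , C#0 , w , z+w≈1 , w-eq  = unit-quotient 1 p _ ≡.refl ≡.refl ≡.refl inv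
             D#0 , V-eq                    = third-quotient p z+w≈1 w-eq
             W#0 , Q#0 , e                 = first-quotients (suc p) _ V-eq
         in (((((d , B#0) , C#0) , D#0) , W#0) , Q#0) ,
            trans (sum-S (3 ℕ.+ p) 1 (λ i → r (suc i)) (λ _ → ≡.refl)) e)

open import Data.Nat.Base using (_*_)
open import Defs
open Polynomial using (con; var)
open FieldOfFractions ℚ[x,y]

-- Nonvanishing of rational functions by evaluation at rational points.

module Specialisation (ρ : Indeterminate → ℚ) where
  open Evaluation ℚ-domain ρ
  open SemiringSolver (CommutativeRing.commutativeSemiring ℚₚ.+-*-commutativeRing)
    using (solve; _:+_; _:*_; _:=_)
  open ≡.≡-Reasoning

  -- Not invariant under ≃: another representative of f may have a denominator
  -- that vanishes at ρ.
  record _↦_ (f : Fraction) (v : ℚ) : Set where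
    constructor regular
    field
      den≢0 : eval (den f) ≢ 0ℚ
      num≡  : eval (num f) ≡ v ℚ.* eval (den f)

  infix 4 _↦_

  *-≢0 : ∀ {u v} → u ≢ 0ℚ → v ≢ 0ℚ → u ℚ.* v ≢ 0ℚ
  *-≢0 = HeytingProperties.x#0y#0→xy#0 ℚₚ.heytingCommutativeRing

  ↦-fromBase : ∀ p → fromBase p ↦ eval p
  ↦-fromBase p = regular ℚₚ.1≢0 (≡.sym (ℚₚ.*-identityʳ (eval p)))

  ↦-+ : ∀ f g {u v} → f ↦ u → g ↦ v → f +ᶠ g ↦ u ℚ.+ v
  ↦-+ (a ÷ b ∣ _) (c ÷ d ∣ _) {u} {v} (regular b≢0 a≡) (regular d≢0 c≡) =
    regular (*-≢0 b≢0 d≢0) (begin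
      eval a ℚ.* eval d ℚ.+ eval c ℚ.* eval b
        ≡⟨ ≡.cong₂ (λ s t → s ℚ.* eval d ℚ.+ t ℚ.* eval b) a≡ c≡ ⟩
      u ℚ.* eval b ℚ.* eval d ℚ.+ v ℚ.* eval d ℚ.* eval b
        ≡⟨ solve 4 (λ u v b d → u :* b :* d :+ v :* d :* b := (u :+ v) :* (b :* d))
             ≡.refl u v (eval b) (eval d) ⟩
      (u ℚ.+ v) ℚ.* (eval b ℚ.* eval d) ∎)

  ↦-* : ∀ f g {u v} → f ↦ u → g ↦ v → f *ᶠ g ↦ u ℚ.* v
  ↦-* (a ÷ b ∣ _) (c ÷ d ∣ _) {u} {v} (regular b≢0 a≡) (regular d≢0 c≡) =
    regular (*-≢0 b≢0 d≢0) (begin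
      eval a ℚ.* eval c
        ≡⟨ ≡.cong₂ ℚ._*_ a≡ c≡ ⟩
      u ℚ.* eval b ℚ.* (v ℚ.* eval d)
        ≡⟨ solve 4 (λ u v b d → u :* b :* (v :* d) := u :* v :* (b :* d))
             ≡.refl u v (eval b) (eval d) ⟩
      u ℚ.* v ℚ.* (eval b ℚ.* eval d) ∎)

  ↦-neg : ∀ f {u} → f ↦ u → -ᶠ f ↦ ℚ.- u
  ↦-neg _ {u} (regular b≢0 a≡) =
    regular b≢0 (≡.trans (≡.cong ℚ.-_ a≡) (ℚₚ.neg-distribˡ-* u _))

  -- If f were zero, its numerator would be the zero polynomial and so vanish at `ρ`.
  ↦-≄0 : ∀ f {v} → f ↦ v → v ≢ 0ℚ → ¬ f ≃ fromBase (con 0ℚ)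
  ↦-≄0 (a ÷ b ∣ _) {v} (regular b≢0 a≡) v≢0 (cross e) = *-≢0 v≢0 b≢0 (begin
    v ℚ.* eval b           ≡⟨ a≡ ⟨
    eval a                 ≡⟨ ℚₚ.*-identityʳ (eval a) ⟨
    eval a ℚ.* 1ℚ          ≡⟨ eval-cong e ⟩
    0ℚ ℚ.* eval b          ≡⟨ ℚₚ.*-zeroˡ (eval b) ⟩
    0ℚ                     ∎)

-- Values of `S`, `G` and `H` at basis vectors.

δ : ℕ → ℕ → ℚ
δ zero    zero    = 1ℚ
δ zero    (suc j) = 0ℚ
δ (suc k) zero    = 0ℚ
δ (suc k) (suc j) = δ k j

δ-refl : ∀ k → δ k k ≡ 1ℚ
δ-refl zero    = ≡.refl
δ-refl (suc k) = δ-refl k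

δ-< : ∀ {k j} → k < j → δ k j ≡ 0ℚ
δ-< {zero}  {suc j} _         = ≡.refl
δ-< {suc k} {suc j} (s≤s k<j) = δ-< k<j

δ-suc : ∀ k → δ (suc k) k ≡ 0ℚ
δ-suc zero    = ≡.refl
δ-suc (suc k) = δ-suc k

-- As `Y j` is y with index j + 1, the only nonzero y here is the one with index k + 1. All x being
-- 1 keeps the tails regular.
basisPoint : ℕ → Indeterminate → ℚ
basisPoint k (X j) = 1ℚ
basisPoint k (Y j) = δ k j

open Expansion ℚ⟮x,y⟯ x y using (r; S; G; H; alternatingSum≈value)

module AtBasisPoint (k : ℕ) where
  open Specialisation (basisPoint k)

  Y-value : ∀ j {v} → δ k j ≡ v → ⟦ y (suc j) ⟧ ↦ v
  Y-value j ≡.refl = ↦-fromBase (var (Y j))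

  r-value : ∀ j {v} → δ k j ≡ v → r (suc j) ↦ v
  r-value j {v} e = ≡.subst (r (suc j) ↦_) (ℚₚ.*-identityʳ v)
    -- The numerator and denominator of the inverse of x both compute to 1 at this point.
    (↦-* (⟦ y (suc j) ⟧) ⟦ x (suc j) ⁻¹ ⟧ (Y-value j e) (regular ℚₚ.1≢0 ≡.refl))

  S-value : ∀ j l {u v} → δ k j ≡ u → S (2 ℕ.+ j) l ↦ v → S (suc j) (suc l) ↦ u ℚ.- v
  S-value j l e s = ↦-+ (r (suc j)) (-ᶠ S (2 ℕ.+ j) l) (r-value j e) (↦-neg (S (2 ℕ.+ j) l) s)

  S-beyond : ∀ j l → k < j → S (suc j) l ↦ 0ℚ
  S-beyond j zero    k<j = ↦-fromBase (con 0ℚ)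
  S-beyond j (suc l) k<j = S-value j l (δ-< k<j) (S-beyond (suc j) l (ℕₚ.m<n⇒m<1+n k<j))

  S-at : ∀ l → S (suc k) (suc l) ↦ 1ℚ
  S-at l = S-value k l (δ-refl k) (S-beyond (suc k) l ℕₚ.≤-refl)

module AtNextBasisPoint (k : ℕ) where
  open Specialisation (basisPoint (suc k))
  open AtBasisPoint (suc k)

  S-after : ∀ l → S (3 ℕ.+ k) l ↦ 0ℚ
  S-after l = S-beyond (2 ℕ.+ k) l ℕₚ.≤-refl

  -- The tail from k + 2 is 1 and the one from k + 3 is 0, so only the square survives.
  G-value : ∀ p → G (suc k) p ↦ 1ℚ
  G-value p = ↦-+ (s₁ *ᶠ s₁) (-ᶠ (s₀ *ᶠ s₂)) (↦-* s₁ s₁ (S-at p) (S-at p))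
    (↦-neg (s₀ *ᶠ s₂) (↦-* s₀ s₂ (S-value k (suc p) (δ-suc k) (S-at p)) (S-after p)))
    where
    s₀ = S (1 ℕ.+ k) (2 ℕ.+ p)
    s₁ = S (2 ℕ.+ k) (1 ℕ.+ p)
    s₂ = S (3 ℕ.+ k) p

  -- The y with index k + 1 is 0 and the next is 1, which leaves minus the value of G.
  H-value : ∀ p → H (suc k) p ↦ ℚ.- 1ℚ
  H-value p = ↦-+ ((x₀ *ᶠ y₀ +ᶠ -ᶠ y₁) *ᶠ G (suc k) p) (y₀ *ᶠ y₀ *ᶠ s₂)
    (↦-* (x₀ *ᶠ y₀ +ᶠ -ᶠ y₁) (G (suc k) p)
      (↦-+ (x₀ *ᶠ y₀) (-ᶠ y₁)
        (↦-* x₀ y₀ (↦-fromBase (var (X k))) y₀-value)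
        (↦-neg y₁ (Y-value (suc k) (δ-refl (suc k)))))
      (G-value p))
    (↦-* (y₀ *ᶠ y₀) s₂ (↦-* y₀ y₀ y₀-value y₀-value) (S-after p))
    where
    x₀ = ⟦ x (suc k) ⟧
    y₀ = ⟦ y (suc k) ⟧
    y₁ = ⟦ y (2 ℕ.+ k) ⟧
    s₂ = S (3 ℕ.+ k) p
    y₀-value = Y-value k (δ-suc k)

-- The nonvanishing hypotheses in the field of fractions, where apartness is the negation of `≃`.

S-#0 : ∀ k l → ¬ S (suc k) (suc l) ≃ fromBase (con 0ℚ)
S-#0 k l = Specialisation.↦-≄0 (basisPoint k) (S (suc k) (suc l)) (AtBasisPoint.S-at k l) ℚₚ.1≢0

G-#0 : ∀ k p → ¬ G (suc k) p ≃ fromBase (con 0ℚ)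
G-#0 k p = Specialisation.↦-≄0 (basisPoint (suc k)) (G (suc k) p) (AtNextBasisPoint.G-value k p) ℚₚ.1≢0

H-#0 : ∀ k p → ¬ H (suc k) p ≃ fromBase (con 0ℚ)
H-#0 k p = Specialisation.↦-≄0 (basisPoint (suc k)) (H (suc k) p) (AtNextBasisPoint.H-value k p) λ ()

theorem3 : ∀ (n : ℕ) → 2 ≤ n →
    Σ[ d ∈ Defined a b 1 (3 * n ∸ 4) ]
    alternatingSum x y n ≈ value a b 1 (3 * n ∸ 4) d
theorem3 = alternatingSum≈value S-#0 G-#0 H-#0
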